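{- Let $m,d$ be positive integers, let $U_{m,d}$ be the uniform matroid of rank $d$ on $m+d$ elements, and let $z_{m,d}^i$ be the coefficient of $t^i$ in its $Z$-polynomial $Z_{U_{m,d}}(t)$. Then $z_{m,d}^d=1$, and for every $0\le i\le d-1$, \[ z_{m,d}^i=\frac{\binom{d+2m}{i+m}\binom{d}{i}}{\binom{d+2m}{m}}\sum_{h=1}^{m}\frac{(-1)^{h+1}h}{m}\binom{i+m}{m-h}\binom{d-i-h+m-1}{m-1}. \]
   Context: Binomial coefficients are $\binom{x}{h}=x(x-1)\cdots(x-h+1)/h!$ for integers $h\ge0$. For a loopless matroid $M$ with lattice of flats $L(M)$, characteristic polynomial $\chi_M(t)$ and rank $\operatorname{rk}M$, the Kazhdan–Lusztig polynomial $P_M(t)$ is the unique assignment with $P_M=1$ if $\operatorname{rk}M=0$, $\deg P_M<\frac12\operatorname{rk}M$ if $\operatorname{rk}M>0$, and $t^{\operatorname{rk}M}P_M(t^{ -1})=\sum_{F\in L(M)}\chi_{M_F}(t)P_{M^F}(t)$, where $M_F$ is the restriction of $M$ to the flat $F$ and $M^F$ is the contraction of $M$ by $F$. The $Z$-polynomial is $Z_M(t)=\sum_{F\in L(M)}t^{\operatorname{rk}M_F}P_{M^F}(t)$. -}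

module Defs where

open import Data.Bool using (Bool; true; false; _∧_; _∨_; not; if_then_else_)
open import Data.Nat using (ℕ; zero; suc; _+_; _*_; _∸_; _≤_; _<_; _⊓_; _≤ᵇ_; _<ᵇ_; _≡ᵇ_)
open import Data.Integer as ℤ using (ℤ; +_; -_)
open import Data.Fin using (Fin)
open import Data.Fin.Subset using (Subset; _⊆_; _∈_; _∪_; _∩_; _─_; ∣_∣; ⁅_⁆; ⊤)
open import Data.Vec using (Vec; []; _∷_; lookup; zipWith; foldr)
open import Data.List using (List; []; _∷_; map; filter; upTo; _++_; allFin)
open import Data.List.Base using () renaming (foldr to lfoldr)
open import Data.Product using (_×_)
open import Relation.Binary.PropositionalEquality using (_≡_)

-- Polynomials with integer coefficients, as coefficient sequences:
-- p i is the coefficient of t^i.  (All polynomials below have finite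
-- support; products are finite convolutions.)

Poly : Set
Poly = ℕ → ℤ

0P : Poly
0P _ = + 0

_+P_ : Poly → Poly → Poly
(p +P q) i = p i ℤ.+ q i

sumℤ : List ℤ → ℤ
sumℤ = lfoldr ℤ._+_ (+ 0)

_*P_ : Poly → Poly → Poly
(p *P q) i = sumℤ (map (λ j → p j ℤ.* q (i ∸ j)) (upTo (suc i)))

monomial : ℤ → ℕ → Poly
monomial c k i = if i ≡ᵇ k then c else + 0

shift : ℕ → Poly → Poly
shift k p i = if k ≤ᵇ i then p (i ∸ k) else + 0

-- t^r * p(t^{-1})  (for deg p ≤ r)
reflect : ℕ → Poly → Poly
reflect r p i = if i ≤ᵇ r then p (r ∸ i) else + 0

sumP : List Poly → Poly
sumP = lfoldr _+P_ 0P

allSubsets : (n : ℕ) → List (Subset n)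
allSubsets zero = [] ∷ []
allSubsets (suc n) =
  map (true ∷_) (allSubsets n) ++ map (false ∷_) (allSubsets n)

subsetᵇ : ∀ {n} → Subset n → Subset n → Bool
subsetᵇ [] [] = true
subsetᵇ (a ∷ A) (b ∷ B) = (not a ∨ b) ∧ subsetᵇ A B

allᵇ : ∀ {A : Set} → (A → Bool) → List A → Bool
allᵇ f = lfoldr (λ x b → f x ∧ b) true

-- Matroids, given by a ground set E ⊆ Fin n and a rank function.
-- The rank function is only meaningful on subsets of the ground set.

record RawMatroid (n : ℕ) : Set where
  constructor mkMatroid
  field
    ground : Subset n
    rk     : Subset n → ℕ
open RawMatroid public

record IsMatroid {n : ℕ} (M : RawMatroid n) : Set where
  field
    rk-bound : ∀ A → A ⊆ ground M → rk M A ≤ ∣ A ∣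
    rk-mono  : ∀ A B → A ⊆ B → B ⊆ ground M → rk M A ≤ rk M B
    rk-submod : ∀ A B → A ⊆ ground M → B ⊆ ground M →
                rk M (A ∪ B) + rk M (A ∩ B) ≤ rk M A + rk M B

Loopless : ∀ {n} → RawMatroid n → Set
Loopless M = ∀ e → e ∈ ground M → rk M ⁅ e ⁆ ≡ 1

rank : ∀ {n} → RawMatroid n → ℕ
rank M = rk M (ground M)

isFlatᵇ : ∀ {n} → RawMatroid n → Subset n → Bool
isFlatᵇ {n} M F =
  subsetᵇ F (ground M) ∧
  allᵇ (λ e → not (lookup (ground M) e) ∨ lookup F e ∨
              (rk M F <ᵇ rk M (F ∪ ⁅ e ⁆)))
       (allFin n)

flats : ∀ {n} → RawMatroid n → List (Subset n)
flats {n} M = filter (λ F → Data.Bool._≟_ (isFlatᵇ M F) true) (allSubsets n)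
  where import Data.Bool

restrict : ∀ {n} → RawMatroid n → Subset n → RawMatroid n
restrict M F = mkMatroid F (rk M)

contract : ∀ {n} → RawMatroid n → Subset n → RawMatroid n
contract M F = mkMatroid (ground M ─ F) (λ A → rk M (A ∪ F) ∸ rk M F)

sgn : ℕ → ℤ
sgn zero = + 1
sgn (suc k) = - sgn k

charPoly : ∀ {n} → RawMatroid n → Poly
charPoly {n} M =
  sumP (map (λ A → if subsetᵇ A (ground M)
                   then monomial (sgn ∣ A ∣) (rank M ∸ rk M A)
                   else 0P)
            (allSubsets n))

record IsKLPoly {n : ℕ} (P : RawMatroid n → Poly) : Set where
  field
    kl-rank0 : ∀ M → IsMatroid M → Loopless M → rank M ≡ 0 →
               ∀ i → P M i ≡ monomial (+ 1) 0 i
    kl-deg   : ∀ M → IsMatroid M → Loopless M → 0 < rank M →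
               ∀ i → rank M ≤ 2 * i → P M i ≡ + 0
    kl-rec   : ∀ M → IsMatroid M → Loopless M → ∀ i →
               reflect (rank M) (P M) i ≡
               sumP (map (λ F → charPoly (restrict M F) *P P (contract M F))
                         (flats M)) i

ZPoly : ∀ {n} → (RawMatroid n → Poly) → RawMatroid n → Poly
ZPoly P M = sumP (map (λ F → shift (rk M F) (P (contract M F))) (flats M))

U : (m d : ℕ) → RawMatroid (m + d)
U m d = mkMatroid ⊤ (λ A → ∣ A ∣ ⊓ d)

sumFrom1 : ℕ → (ℕ → ℤ) → ℤ
sumFrom1 m f = sumℤ (map (λ j → f (suc j)) (upTo m))

{-# OPTIONS --safe #-}

-- Write q_s for the Kazhdan–Lusztig polynomial of the uniform matroid of corank m on s elements.
-- A proper flat F of such a matroid is Boolean and its contraction is again uniform of corank m,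
-- so the defining recursion and the Z-polynomial become binomial sums in the q_s, and Möbius
-- inversion over Boolean lattices shows that Z is palindromic.  Put z(k,i) = [t^i] Z for rank k + i.
-- Palindromicity says z(k,i) = z(i,k) and z(k,0) = 1, while inverting Z = Σ_F t^|F| q_{|E-F|} and
-- using deg q < rank / 2 gives Σ_l (-1)^(i-l) C(m+k+i,i-l) z(k,l) = 0 for i ≥ k; together these
-- determine z.  The claimed formula satisfies both:
--   * it equals C(m+k+i,i) / k times a polynomial in i of degree less than k, whose i-th finite
--     difference vanishes when i ≥ k;
--   * its alternating sum over h equals Σ_{s<m} (m-s) C(k-1+s,s) C(i-1+s,s), symmetric in k and i.

module Submission where

open import Defs
open import Data.Bool using (Bool; true; false; if_then_else_; not; _∧_; _∨_)
import Data.Bool as Bool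
open import Data.Bool.Properties using (∧-zeroʳ)
open import Data.Empty using (⊥-elim)
open import Data.Fin using (Fin; zero; suc)
open import Data.Fin.Subset using (Subset; _⊆_; _∈_; _∪_; _∩_; _─_; ∣_∣; ⁅_⁆)
open import Data.Fin.Subset.Properties
open import Data.Integer as ℤ using (ℤ; +_; -_)
import Data.Integer.Properties as ℤₚ
open import Data.Integer.Tactic.RingSolver using (solve-∀)
open import Data.List using ([]; _∷_; map; upTo; _++_; filter; allFin)
open import Data.List.Membership.Propositional using () renaming (_∈_ to _∈ˡ_)
open import Data.List.Membership.Propositional.Properties using (∈-allFin)
open import Data.List.Properties using (upTo-∷ʳ; map-++; map-∘)
open import Data.List.Relation.Unary.Any using (here; there)
open import Data.Nat using (ℕ; zero; suc; _+_; _*_; _∸_; _⊓_; _!; _≤_; _<_; z≤n; s≤s; z<s; _≡ᵇ_; _<ᵇ_; _≤ᵇ_; _≟_; NonZero; >-nonZero)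
open import Data.Nat.Combinatorics using (_C_; nCk+nC[k+1]≡[n+1]C[k+1]; nCn≡1; nCk≡nC[n∸k]; k>n⇒nCk≡0; nCk≡n!/k![n-k]!; k![n∸k]!∣n!)
open import Data.Nat.DivMod using (m/n*n≡m)
open import Data.Nat.Induction using (<-rec)
open import Data.Nat.Properties hiding (_≟_)
import Data.Nat.Tactic.RingSolver as ℕ-Solver
open import Data.Product using (_×_; _,_; ∃)
open import Data.Sum using (inj₁; inj₂)
open import Data.Vec using ([]; _∷_; lookup; here; there)
open import Data.Vec.Properties using (lookup⇒[]=)
open import Function using (_∘_)
open import Relation.Nullary using (yes; no)
open import Relation.Binary.PropositionalEquality

open ≡-Reasoning

-- The hypotheses give an arbitrary assignment `P` on raw matroids, not assumed invariant under
-- isomorphism or even under extensional equality of rank functions. Before there is a sequence `q`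
-- at all, `P` has to be shown to depend on the size alone for uniform matroids of corank `m`. The
-- zero convention for small sizes discards the top flat together with the spanning sets that are
-- not flats, so `uniformZ` is Z without its top power of t, which reappears as separate monomials.
--
-- The recurrence closes up because a factor t^j in the inversion lowers rank and degree alike: k =
-- rank - degree stays fixed, and each k gives a triangular system in i with leading coefficient 1.
-- It is available for i ≥ k since the rank k + i is then at most 2i. Entries with i < k come from
-- the symmetry, which mixes different k and forces induction on the rank.
--
-- Denominators are cleared throughout, in two forms of the same formula: one displays the symmetry
-- in k and i, the other is a binomial coefficient times a polynomial in i, which a finite
-- difference annihilates.

-- Binomial sums over splittings and inversion on Boolean lattices

-- Sums over the splittings of an n-element set into two parts:
-- bsum n f = Σ_a C(n,a) f a (n - a).
bsum : ℕ → (ℕ → ℕ → ℤ) → ℤ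
bsum zero    f = f 0 0
bsum (suc n) f = bsum n (λ a b → f (suc a) b) ℤ.+ bsum n (λ a b → f a (suc b))

+-interchange : ∀ a b c d → (a ℤ.+ b) ℤ.+ (c ℤ.+ d) ≡ (a ℤ.+ c) ℤ.+ (b ℤ.+ d)
+-interchange = solve-∀

bsum-cong : ∀ n {f g} → (∀ a b → a + b ≡ n → f a b ≡ g a b) → bsum n f ≡ bsum n g
bsum-cong zero    h = h 0 0 refl
bsum-cong (suc n) h = cong₂ ℤ._+_
  (bsum-cong n λ a b e → h (suc a) b (cong suc e))
  (bsum-cong n λ a b e → h a (suc b) (trans (+-suc a b) (cong suc e)))

bsum-+ : ∀ n f g → bsum n (λ a b → f a b ℤ.+ g a b) ≡ bsum n f ℤ.+ bsum n g
bsum-+ zero    f g = refl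
bsum-+ (suc n) f g = trans (cong₂ ℤ._+_ (bsum-+ n _ _) (bsum-+ n _ _))
  (+-interchange (bsum n (λ a b → f (suc a) b)) (bsum n (λ a b → g (suc a) b)) _ _)

bsum-* : ∀ n c f → bsum n (λ a b → c ℤ.* f a b) ≡ c ℤ.* bsum n f
bsum-* zero    c f = refl
bsum-* (suc n) c f = trans (cong₂ ℤ._+_ (bsum-* n c _) (bsum-* n c _))
  (sym (ℤₚ.*-distribˡ-+ c _ _))

bsum-zero : ∀ n {f} → (∀ a b → a + b ≡ n → f a b ≡ + 0) → bsum n f ≡ + 0
bsum-zero zero    h = h 0 0 refl
bsum-zero (suc n) h = cong₂ ℤ._+_
  (bsum-zero n λ a b e → h (suc a) b (cong suc e))
  (bsum-zero n λ a b e → h a (suc b) (trans (+-suc a b) (cong suc e)))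

bsum-emptyˡ : ∀ n {f} → (∀ a b → suc a + b ≡ n → f (suc a) b ≡ + 0) → bsum n f ≡ f 0 n
bsum-emptyˡ zero    h = refl
bsum-emptyˡ (suc n) h = trans (cong₂ ℤ._+_
  (bsum-zero n λ a b e → h a b (cong suc e))
  (bsum-emptyˡ n λ a b e → h a (suc b) (trans (cong suc (+-suc a b)) (cong suc e))))
  (ℤₚ.+-identityˡ _)

bsum-emptyʳ : ∀ n {f} → (∀ a b → a + suc b ≡ n → f a (suc b) ≡ + 0) → bsum n f ≡ f n 0
bsum-emptyʳ zero    h = refl
bsum-emptyʳ (suc n) h = trans (cong₂ ℤ._+_
  (bsum-emptyʳ n λ a b e → h (suc a) b (cong suc e))
  (bsum-zero n λ a b e → h a b (trans (+-suc a b) (cong suc e))))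
  (ℤₚ.+-identityʳ _)

-- Both sides run over the splittings into three parts: the first element joins part `a`, `b` or
-- `c`, and the two sides only bracket these three sums differently.
bsum-assoc : ∀ n (f : ℕ → ℕ → ℕ → ℤ) →
  bsum n (λ a r → bsum r (f a)) ≡ bsum n (λ s c → bsum s (λ a b → f a b c))
bsum-assoc zero    f = refl
bsum-assoc (suc n) f = begin
  x ℤ.+ bsum n (λ a r → bsum r (λ b → f a (suc b)) ℤ.+ bsum r (λ b c → f a b (suc c)))
    ≡⟨ cong (ℤ._+_ x) (bsum-+ n _ _) ⟩
  x ℤ.+ (y ℤ.+ z)
    ≡⟨ ℤₚ.+-assoc x y z ⟨
  (x ℤ.+ y) ℤ.+ z
    ≡⟨ cong₂ ℤ._+_ (cong₂ ℤ._+_ (bsum-assoc n _) (bsum-assoc n _)) (bsum-assoc n _) ⟩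
  (x′ ℤ.+ y′) ℤ.+ z′
    ≡⟨ cong (ℤ._+ z′) (bsum-+ n (λ s c → bsum s (λ a b → f (suc a) b c)) _) ⟨
  bsum n (λ s c → bsum s (λ a b → f (suc a) b c) ℤ.+ bsum s (λ a b → f a (suc b) c)) ℤ.+ z′ ∎
  where
  x = bsum n (λ a r → bsum r (f (suc a)))
  y = bsum n (λ a r → bsum r (λ b → f a (suc b)))
  z = bsum n (λ a r → bsum r (λ b c → f a b (suc c)))
  x′ = bsum n (λ s c → bsum s (λ a b → f (suc a) b c))
  y′ = bsum n (λ s c → bsum s (λ a b → f a (suc b) c))
  z′ = bsum n (λ s c → bsum s (λ a b → f a b (suc c)))

-- Moving the first element to the other part changes the sign and nothing else, so the terms cancel
-- in pairs.
bsum-sgnˡ : ∀ n c → bsum (suc n) (λ a _ → sgn a ℤ.* c) ≡ + 0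
bsum-sgnˡ n c = trans (sym (bsum-+ n _ _)) (bsum-zero n λ a _ _ → cancel (sgn a) c)
  where
  cancel : ∀ s c → (- s) ℤ.* c ℤ.+ s ℤ.* c ≡ + 0
  cancel = solve-∀

bsum-sgnʳ : ∀ n c → bsum (suc n) (λ _ b → sgn b ℤ.* c) ≡ + 0
bsum-sgnʳ n c = trans (sym (bsum-+ n _ _)) (bsum-zero n λ _ b _ → cancel (sgn b) c)
  where
  cancel : ∀ s c → s ℤ.* c ℤ.+ (- s) ℤ.* c ≡ + 0
  cancel = solve-∀

-- The two cancellations below are Möbius inversion on a Boolean lattice.
bsum-invertˡ : ∀ n (x : ℕ → ℕ → ℤ) →
  bsum n (λ a r → bsum r (λ b c → sgn a ℤ.* x (a + b) c)) ≡ x 0 n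
bsum-invertˡ n x = begin
  bsum n (λ a r → bsum r (λ b c → sgn a ℤ.* x (a + b) c))
    ≡⟨ bsum-assoc n (λ a b c → sgn a ℤ.* x (a + b) c) ⟩
  bsum n (λ s c → bsum s (λ a b → sgn a ℤ.* x (a + b) c))
    ≡⟨ bsum-cong n (λ s c _ → bsum-cong s λ a b e → cong (λ t → sgn a ℤ.* x t c) e) ⟩
  bsum n (λ s c → bsum s (λ a b → sgn a ℤ.* x s c))
    ≡⟨ bsum-emptyˡ n (λ s c _ → bsum-sgnˡ s (x (suc s) c)) ⟩
  + 1 ℤ.* x 0 n
    ≡⟨ ℤₚ.*-identityˡ _ ⟩
  x 0 n ∎

bsum-invertʳ : ∀ n (y : ℕ → ℤ) →
  bsum n (λ _ r → bsum r (λ b c → sgn b ℤ.* y c)) ≡ y n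
bsum-invertʳ n y = begin
  bsum n (λ _ r → bsum r (λ b c → sgn b ℤ.* y c))
    ≡⟨ bsum-assoc n (λ _ b c → sgn b ℤ.* y c) ⟩
  bsum n (λ s c → bsum s (λ _ b → sgn b ℤ.* y c))
    ≡⟨ bsum-emptyˡ n (λ s c _ → bsum-sgnʳ s (y c)) ⟩
  + 1 ℤ.* y n
    ≡⟨ ℤₚ.*-identityˡ _ ⟩
  y n ∎

-- Finite sums and coefficients of shifted and reflected polynomials

Σ< : ℕ → (ℕ → ℤ) → ℤ
Σ< zero    f = + 0
Σ< (suc n) f = Σ< n f ℤ.+ f n

Σ<-cong : ∀ n {f g} → (∀ h → h < n → f h ≡ g h) → Σ< n f ≡ Σ< n g
Σ<-cong zero    e = refl
Σ<-cong (suc n) e = cong₂ ℤ._+_ (Σ<-cong n λ h h<n → e h (m<n⇒m<1+n h<n)) (e n ≤-refl)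

Σ<-+ : ∀ n f g → Σ< n (λ h → f h ℤ.+ g h) ≡ Σ< n f ℤ.+ Σ< n g
Σ<-+ zero    f g = refl
Σ<-+ (suc n) f g = trans (cong (ℤ._+ (f n ℤ.+ g n)) (Σ<-+ n f g)) (+-interchange (Σ< n f) _ _ _)

Σ<-* : ∀ n c f → Σ< n (λ h → c ℤ.* f h) ≡ c ℤ.* Σ< n f
Σ<-* zero    c f = sym (ℤₚ.*-zeroʳ c)
Σ<-* (suc n) c f = trans (cong (ℤ._+ (c ℤ.* f n)) (Σ<-* n c f)) (sym (ℤₚ.*-distribˡ-+ c _ _))

Σ<-zero : ∀ n {f} → (∀ h → h < n → f h ≡ + 0) → Σ< n f ≡ + 0
Σ<-zero zero    e = refl
Σ<-zero (suc n) e = cong₂ ℤ._+_ (Σ<-zero n λ h h<n → e h (m<n⇒m<1+n h<n)) (e n ≤-refl)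

Σ<-head : ∀ n f → Σ< (suc n) f ≡ f 0 ℤ.+ Σ< n (λ h → f (suc h))
Σ<-head zero    f = ℤₚ.+-comm (+ 0) (f 0)
Σ<-head (suc n) f = trans (cong (ℤ._+ f (suc n)) (Σ<-head n f)) (ℤₚ.+-assoc (f 0) _ _)

bsum-Σ< : ∀ n m (f : ℕ → ℕ → ℕ → ℤ) →
  bsum n (λ a b → Σ< m (f a b)) ≡ Σ< m (λ h → bsum n (λ a b → f a b h))
bsum-Σ< n zero    f = bsum-zero n λ _ _ _ → refl
bsum-Σ< n (suc m) f = trans (bsum-+ n _ _) (cong (ℤ._+ bsum n (λ a b → f a b m)) (bsum-Σ< n m f))

sumℤ-++ : ∀ xs ys → sumℤ (xs ++ ys) ≡ sumℤ xs ℤ.+ sumℤ ys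
sumℤ-++ []       ys = sym (ℤₚ.+-identityˡ _)
sumℤ-++ (x ∷ xs) ys = trans (cong (ℤ._+_ x) (sumℤ-++ xs ys)) (sym (ℤₚ.+-assoc x _ _))

sumℤ-upTo : ∀ n f → sumℤ (map f (upTo n)) ≡ Σ< n f
sumℤ-upTo zero    f = refl
sumℤ-upTo (suc n) f = begin
  sumℤ (map f (upTo (suc n)))             ≡⟨ cong (λ l → sumℤ (map f l)) (upTo-∷ʳ n) ⟨
  sumℤ (map f (upTo n ++ n ∷ []))         ≡⟨ cong sumℤ (map-++ f (upTo n) (n ∷ [])) ⟩
  sumℤ (map f (upTo n) ++ f n ∷ [])       ≡⟨ sumℤ-++ (map f (upTo n)) (f n ∷ []) ⟩
  sumℤ (map f (upTo n)) ℤ.+ (f n ℤ.+ + 0) ≡⟨ cong₂ ℤ._+_ (sumℤ-upTo n f) (ℤₚ.+-identityʳ (f n)) ⟩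
  Σ< n f ℤ.+ f n                          ∎

monomial-scale : ∀ c k i → monomial c k i ≡ c ℤ.* monomial (+ 1) k i
monomial-scale c k i with i ≡ᵇ k
... | true  = sym (ℤₚ.*-identityʳ c)
... | false = sym (ℤₚ.*-zeroʳ c)

monomial-diag : ∀ c k → monomial c k k ≡ c
monomial-diag c zero    = refl
monomial-diag c (suc k) = monomial-diag c k

monomial-off : ∀ c k i → i ≢ k → monomial c k i ≡ + 0
monomial-off c zero    zero    i≢k = ⊥-elim (i≢k refl)
monomial-off c zero    (suc i) i≢k = refl
monomial-off c (suc k) zero    i≢k = refl
monomial-off c (suc k) (suc i) i≢k = monomial-off c k i λ e → i≢k (cong suc e)

shift-suc : ∀ k p i → shift (suc k) p (suc i) ≡ shift k p i
shift-suc zero    p i = refl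
shift-suc (suc k) p i = refl

shift-≥ : ∀ k p i → k ≤ i → shift k p i ≡ p (i ∸ k)
shift-≥ zero    p i       _         = refl
shift-≥ (suc k) p (suc i) (s≤s k≤i) = trans (shift-suc k p i) (shift-≥ k p i k≤i)

shift-< : ∀ k p i → i < k → shift k p i ≡ + 0
shift-< (suc k) p zero    _         = refl
shift-< (suc k) p (suc i) (s≤s i<k) = trans (shift-suc k p i) (shift-< k p i i<k)

shift-+ : ∀ k p i → shift k p (k + i) ≡ p i
shift-+ k p i = trans (shift-≥ k p (k + i) (m≤m+n k i)) (cong p (m+n∸m≡n k i))

shift-cong : ∀ k {p q : Poly} i → (∀ l → k + l ≡ i → p l ≡ q l) → shift k p i ≡ shift k q i
shift-cong k {p} {q} i e with k ≤? i
... | yes k≤i = trans (shift-≥ k p i k≤i) (trans (e (i ∸ k) (m+[n∸m]≡n k≤i)) (sym (shift-≥ k q i k≤i)))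
... | no  k≰i = trans (shift-< k p i (≰⇒> k≰i)) (sym (shift-< k q i (≰⇒> k≰i)))

shift-zero : ∀ k {p : Poly} i → (∀ l → k + l ≡ i → p l ≡ + 0) → shift k p i ≡ + 0
shift-zero k {p} i e with k ≤? i
... | yes k≤i = trans (shift-≥ k p i k≤i) (e (i ∸ k) (m+[n∸m]≡n k≤i))
... | no  k≰i = shift-< k p i (≰⇒> k≰i)

shift-bsum : ∀ k n (f : ℕ → ℕ → Poly) i →
  shift k (λ l → bsum n (λ a b → f a b l)) i ≡ bsum n (λ a b → shift k (f a b) i)
shift-bsum k n f i with k ≤? i
... | yes k≤i = trans (shift-≥ k (λ l → bsum n (λ a b → f a b l)) i k≤i) (bsum-cong n λ a b _ → sym (shift-≥ k (f a b) i k≤i))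
... | no  k≰i = trans (shift-< k (λ l → bsum n (λ a b → f a b l)) i (≰⇒> k≰i)) (sym (bsum-zero n λ a b _ → shift-< k (f a b) i (≰⇒> k≰i)))

shift-shift : ∀ k l p i → shift k (shift l p) i ≡ shift (k + l) p i
shift-shift zero    l p i       = refl
shift-shift (suc k) l p zero    = refl
shift-shift (suc k) l p (suc i) = trans (shift-suc k (shift l p) i) (trans (shift-shift k l p i) (sym (shift-suc (k + l) p i)))

reflect-+ : ∀ p i l → reflect (i + l) p i ≡ p l
reflect-+ p zero    l = refl
reflect-+ p (suc zero) l = refl
reflect-+ p (suc (suc i)) l = reflect-+ p (suc i) l

reflect-> : ∀ r p i → r < i → reflect r p i ≡ + 0
reflect-> zero p (suc i) _ = refl
reflect-> (suc r) p (suc (suc i)) (s≤s r<i) = reflect-> r p (suc i) r<i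

-- Binomial coefficients and powers of 1 - t

pascal : ∀ n k → suc n C suc k ≡ n C k + n C suc k
pascal n k = sym (nCk+nC[k+1]≡[n+1]C[k+1] n k)

-- negBin m lists the coefficients of (1 - t)^(-m).
negBin : ℕ → Poly
negBin zero    q       = monomial (+ 1) 0 q
negBin (suc m) zero    = + 1
negBin (suc m) (suc q) = negBin (suc m) q ℤ.+ negBin m (suc q)

negBin-0 : ∀ m → negBin m 0 ≡ + 1
negBin-0 zero    = refl
negBin-0 (suc m) = refl

negBin-1 : ∀ q → negBin 1 q ≡ + 1
negBin-1 zero    = refl
negBin-1 (suc q) = cong (ℤ._+ + 0) (negBin-1 q)

-- The coefficient form of (1 - t) (1 - t)^(-m-1) = (1 - t)^(-m), multiplied by t^a.
shift-negBin : ∀ a m k →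
  shift a (negBin (suc m)) k ≡ shift (suc a) (negBin (suc m)) k ℤ.+ shift a (negBin m) k
shift-negBin zero    m zero    = sym (trans (ℤₚ.+-identityˡ _) (negBin-0 m))
shift-negBin zero    m (suc k) = refl
shift-negBin (suc a) m zero    = refl
shift-negBin (suc a) m (suc k) = begin
  shift (suc a) (negBin (suc m)) (suc k)
    ≡⟨ shift-suc a (negBin (suc m)) k ⟩
  shift a (negBin (suc m)) k
    ≡⟨ shift-negBin a m k ⟩
  shift (suc a) (negBin (suc m)) k ℤ.+ shift a (negBin m) k
    ≡⟨ cong₂ ℤ._+_ (shift-suc (suc a) (negBin (suc m)) k) (shift-suc a (negBin m) k) ⟨
  shift (suc (suc a)) (negBin (suc m)) (suc k) ℤ.+ shift (suc a) (negBin m) (suc k) ∎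

negBin-C : ∀ m q → negBin (suc m) q ≡ + ((q + m) C m)
negBin-C zero    q       = negBin-1 q
negBin-C (suc m) zero    = cong +_ (sym (nCn≡1 (suc m)))
negBin-C (suc m) (suc q) = begin
  negBin (suc (suc m)) q ℤ.+ negBin (suc m) (suc q)
    ≡⟨ cong₂ ℤ._+_ (negBin-C (suc m) q) (negBin-C m (suc q)) ⟩
  + ((q + suc m) C suc m + (suc q + m) C m)
    ≡⟨ cong +_ (+-comm ((q + suc m) C suc m) _) ⟩
  + ((suc q + m) C m + (q + suc m) C suc m)
    ≡⟨ cong (λ t → + (t C m + (q + suc m) C suc m)) (sym (+-suc q m)) ⟩
  + ((q + suc m) C m + (q + suc m) C suc m)
    ≡⟨ cong +_ (pascal (q + suc m) m) ⟨
  + (suc (q + suc m) C suc m) ∎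

-- The alternating sum over splittings expands (1 - t)^n, so this reads (1 - t)^n (1 - t)^(-n-r) =
-- (1 - t)^(-r) at t^k.
bsum-negBin : ∀ n r k →
  bsum n (λ a _ → sgn a ℤ.* shift a (negBin (n + r)) k) ≡ negBin r k
bsum-negBin zero    r k = ℤₚ.*-identityˡ _
bsum-negBin (suc n) r k = begin
  bsum n (λ a _ → (- sgn a) ℤ.* shift (suc a) p k) ℤ.+ bsum n (λ a _ → sgn a ℤ.* shift a p k)
    ≡⟨ bsum-+ n _ _ ⟨
  bsum n (λ a _ → (- sgn a) ℤ.* shift (suc a) p k ℤ.+ sgn a ℤ.* shift a p k)
    ≡⟨ bsum-cong n (λ a _ _ → trans
         (cong (λ t → (- sgn a) ℤ.* shift (suc a) p k ℤ.+ sgn a ℤ.* t) (shift-negBin a (n + r) k))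
         (lem (sgn a) (shift (suc a) p k) (shift a (negBin (n + r)) k))) ⟩
  bsum n (λ a _ → sgn a ℤ.* shift a (negBin (n + r)) k)
    ≡⟨ bsum-negBin n r k ⟩
  negBin r k ∎
  where
  p = negBin (suc n + r)
  lem : ∀ s x y → (- s) ℤ.* x ℤ.+ s ℤ.* (x ℤ.+ y) ≡ s ℤ.* y
  lem = solve-∀

C-absorb : ∀ n h → suc h * (suc n C suc h) ≡ suc n * (n C h)
C-absorb zero    zero    = refl
C-absorb zero    (suc h) = *-zeroʳ (suc (suc h))
C-absorb (suc n) zero    = begin
  1 * (suc (suc n) C 1)         ≡⟨ cong (1 *_) (pascal (suc n) 0) ⟩
  1 * (1 + suc n C 1)           ≡⟨ cong (λ t → 1 * (1 + t)) (trans (sym (*-identityˡ _)) (C-absorb n 0)) ⟩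
  1 * (1 + suc n * 1)           ≡⟨ lem (suc n) ⟩
  suc (suc n) * 1               ∎
  where
  lem : ∀ n → 1 * (1 + n * 1) ≡ suc n * 1
  lem = ℕ-Solver.solve-∀
C-absorb (suc n) (suc h) = begin
  suc (suc h) * (suc (suc n) C suc (suc h))
    ≡⟨ cong (suc (suc h) *_) (pascal (suc n) (suc h)) ⟩
  suc (suc h) * (x + y)
    ≡⟨ lem₁ (suc h) x y ⟩
  suc h * x + suc (suc h) * y + x
    ≡⟨ cong₂ (λ s t → s + t + x) (C-absorb n h) (C-absorb n (suc h)) ⟩
  suc n * (n C h) + suc n * (n C suc h) + x
    ≡⟨ cong (λ t → suc n * (n C h) + suc n * (n C suc h) + t) (pascal n h) ⟩
  suc n * (n C h) + suc n * (n C suc h) + (n C h + n C suc h)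
    ≡⟨ lem₂ (suc n) (n C h) (n C suc h) ⟩
  suc (suc n) * (n C h + n C suc h)
    ≡⟨ cong (suc (suc n) *_) (pascal n h) ⟨
  suc (suc n) * (suc n C suc h) ∎
  where
  x = suc n C suc h
  y = suc n C suc (suc h)
  lem₁ : ∀ h x y → suc h * (x + y) ≡ h * x + suc h * y + x
  lem₁ = ℕ-Solver.solve-∀
  lem₂ : ∀ n x y → n * x + n * y + (x + y) ≡ suc n * (x + y)
  lem₂ = ℕ-Solver.solve-∀

Σ<-binomial : ∀ n f → Σ< (suc n) (λ h → + (n C h) ℤ.* f h) ≡ bsum n (λ a _ → f a)
Σ<-binomial zero    f = trans (ℤₚ.+-identityˡ _) (ℤₚ.*-identityˡ _)
Σ<-binomial (suc n) f = begin
  Σ< (suc (suc n)) (λ h → + (suc n C h) ℤ.* f h)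
    ≡⟨ Σ<-head (suc n) _ ⟩
  f₀ ℤ.+ Σ< (suc n) (λ h → + (suc n C suc h) ℤ.* f (suc h))
    ≡⟨ cong (ℤ._+_ f₀) (trans (Σ<-cong (suc n) λ h _ → trans (cong (λ t → + t ℤ.* f (suc h)) (pascal n h)) (ℤₚ.*-distribʳ-+ (f (suc h)) (+ (n C h)) (+ (n C suc h)))) (Σ<-+ (suc n) _ _)) ⟩
  f₀ ℤ.+ (S₁ ℤ.+ S₂)
    ≡⟨ lem f₀ S₁ S₂ ⟩
  S₁ ℤ.+ (f₀ ℤ.+ S₂)
    ≡⟨ cong (ℤ._+_ S₁) (Σ<-head (suc n) (λ h → + (n C h) ℤ.* f h)) ⟨
  S₁ ℤ.+ (Σ< (suc n) (λ h → + (n C h) ℤ.* f h) ℤ.+ + (n C suc n) ℤ.* f (suc n))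
    ≡⟨ cong (λ t → S₁ ℤ.+ (Σ< (suc n) (λ h → + (n C h) ℤ.* f h) ℤ.+ + t ℤ.* f (suc n))) (k>n⇒nCk≡0 (n<1+n n)) ⟩
  S₁ ℤ.+ (Σ< (suc n) (λ h → + (n C h) ℤ.* f h) ℤ.+ + 0)
    ≡⟨ cong₂ ℤ._+_ (Σ<-binomial n (λ h → f (suc h))) (trans (ℤₚ.+-identityʳ _) (Σ<-binomial n f)) ⟩
  bsum (suc n) (λ a _ → f a) ∎
  where
  f₀ = + 1 ℤ.* f 0
  S₁ = Σ< (suc n) (λ h → + (n C h) ℤ.* f (suc h))
  S₂ = Σ< (suc n) (λ h → + (n C suc h) ℤ.* f (suc h))
  lem : ∀ a b c → a ℤ.+ (b ℤ.+ c) ≡ b ℤ.+ (a ℤ.+ c)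
  lem = solve-∀

-- Symmetry of the alternating sum in k and i

-- With `k` for d - i, the summand of index `h + 1` in the theorem, without the factor 1/m. The
-- coefficient of t^(k-h-1) in (1 - t)^(-m) stands for the last binomial, and `shift` makes it 0
-- once h + 1 > k.
altTerm : ℕ → ℕ → ℕ → ℕ → ℤ
altTerm m k i h = sgn h ℤ.* (+ suc h ℤ.* (+ ((i + m) C (m ∸ suc h)) ℤ.* shift (suc h) (negBin m) k))

altSum : ℕ → ℕ → ℕ → ℤ
altSum m k i = Σ< m (altTerm m k i)

-- Each summand is a function of `i` times a function of `k`, and by Pascal the difference of either
-- factor is the corresponding factor for `m` in place of `suc m`. The mixed second difference of
-- such a product is the product of the two differences.
altSum-rec : ∀ m k i →
  altSum (suc m) (suc k) (suc i) ℤ.+ altSum (suc m) k i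
    ≡ (altSum (suc m) k (suc i) ℤ.+ altSum (suc m) (suc k) i) ℤ.+ altSum m (suc k) (suc i)
altSum-rec m k i = begin
  (Σ< m (t 1 1) ℤ.+ t 1 1 m) ℤ.+ (Σ< m (t 0 0) ℤ.+ t 0 0 m)
    ≡⟨ +-interchange (Σ< m (t 1 1)) (t 1 1 m) (Σ< m (t 0 0)) (t 0 0 m) ⟩
  (Σ< m (t 1 1) ℤ.+ Σ< m (t 0 0)) ℤ.+ (t 1 1 m ℤ.+ t 0 0 m)
    ≡⟨ cong₂ ℤ._+_ front back ⟩
  ((Σ< m (t 0 1) ℤ.+ Σ< m (t 1 0)) ℤ.+ altSum m (suc k) (suc i)) ℤ.+ (t 0 1 m ℤ.+ t 1 0 m)
    ≡⟨ rearrange (Σ< m (t 0 1)) (Σ< m (t 1 0)) (altSum m (suc k) (suc i)) (t 0 1 m) (t 1 0 m) ⟩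
  ((Σ< m (t 0 1) ℤ.+ t 0 1 m) ℤ.+ (Σ< m (t 1 0) ℤ.+ t 1 0 m)) ℤ.+ altSum m (suc k) (suc i) ∎
  where
  t : ℕ → ℕ → ℕ → ℤ
  t x y = altTerm (suc m) (x + k) (y + i)
  rearrange : ∀ a b c d e → ((a ℤ.+ b) ℤ.+ c) ℤ.+ (d ℤ.+ e) ≡ ((a ℤ.+ d) ℤ.+ (b ℤ.+ e)) ℤ.+ c
  rearrange = solve-∀
  u₀ u′ : ℕ → ℤ
  u₀ h = shift (suc h) (negBin (suc m)) k
  u′ h = shift (suc h) (negBin m) (suc k)
  u-step : ∀ h → shift (suc h) (negBin (suc m)) (suc k) ≡ u₀ h ℤ.+ u′ h
  u-step h = trans (shift-negBin (suc h) m (suc k)) (cong (ℤ._+ u′ h) (shift-suc (suc h) (negBin (suc m)) k))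
  v-step : ∀ h → h < m → (suc i + suc m) C (m ∸ h) ≡ (i + suc m) C (m ∸ h) + (suc i + m) C (m ∸ suc h)
  v-step h h<m = begin
    (suc i + suc m) C (m ∸ h)                          ≡⟨ cong (suc (i + suc m) C_) m∸h ⟩
    suc (i + suc m) C suc (m ∸ suc h)                  ≡⟨ pascal (i + suc m) (m ∸ suc h) ⟩
    (i + suc m) C (m ∸ suc h) + (i + suc m) C suc (m ∸ suc h)
      ≡⟨ +-comm ((i + suc m) C (m ∸ suc h)) _ ⟩
    (i + suc m) C suc (m ∸ suc h) + (i + suc m) C (m ∸ suc h)
      ≡⟨ cong₂ (λ x y → (i + suc m) C x + y C (m ∸ suc h)) (sym m∸h) (+-suc i m) ⟩
    (i + suc m) C (m ∸ h) + (suc i + m) C (m ∸ suc h) ∎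
    where
    m∸h : m ∸ h ≡ suc (m ∸ suc h)
    m∸h = +-∸-assoc 1 h<m
  expand : ∀ s H v v′ u u′ →
    s ℤ.* (H ℤ.* ((v ℤ.+ v′) ℤ.* (u ℤ.+ u′))) ℤ.+ s ℤ.* (H ℤ.* (v ℤ.* u))
      ≡ (s ℤ.* (H ℤ.* ((v ℤ.+ v′) ℤ.* u)) ℤ.+ s ℤ.* (H ℤ.* (v ℤ.* (u ℤ.+ u′)))) ℤ.+ s ℤ.* (H ℤ.* (v′ ℤ.* u′))
  expand = solve-∀
  term : ∀ h → h < m → t 1 1 h ℤ.+ t 0 0 h ≡ (t 0 1 h ℤ.+ t 1 0 h) ℤ.+ altTerm m (suc k) (suc i) h
  term h h<m rewrite v-step h h<m | u-step h =
    expand (sgn h) (+ suc h) (+ ((i + suc m) C (m ∸ h))) (+ ((suc i + m) C (m ∸ suc h))) (u₀ h) (u′ h)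
  front : Σ< m (t 1 1) ℤ.+ Σ< m (t 0 0) ≡ (Σ< m (t 0 1) ℤ.+ Σ< m (t 1 0)) ℤ.+ altSum m (suc k) (suc i)
  front = begin
    Σ< m (t 1 1) ℤ.+ Σ< m (t 0 0)         ≡⟨ Σ<-+ m (t 1 1) (t 0 0) ⟨
    Σ< m (λ h → t 1 1 h ℤ.+ t 0 0 h)      ≡⟨ Σ<-cong m term ⟩
    Σ< m (λ h → (t 0 1 h ℤ.+ t 1 0 h) ℤ.+ altTerm m (suc k) (suc i) h)
      ≡⟨ Σ<-+ m (λ h → t 0 1 h ℤ.+ t 1 0 h) (altTerm m (suc k) (suc i)) ⟩
    Σ< m (λ h → t 0 1 h ℤ.+ t 1 0 h) ℤ.+ altSum m (suc k) (suc i)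
      ≡⟨ cong (ℤ._+ altSum m (suc k) (suc i)) (Σ<-+ m (t 0 1) (t 1 0)) ⟩
    (Σ< m (t 0 1) ℤ.+ Σ< m (t 1 0)) ℤ.+ altSum m (suc k) (suc i) ∎
  -- At h = m the factor depending on `i` is C(_, 0) = 1, so the mixed difference is zero, in
  -- accordance with `altSum m` having no such summand.
  back : t 1 1 m ℤ.+ t 0 0 m ≡ t 0 1 m ℤ.+ t 1 0 m
  back rewrite n∸n≡0 m = ℤₚ.+-comm (t′ (suc k)) (t′ k)
    where
    t′ : ℕ → ℤ
    t′ k = sgn m ℤ.* (+ suc m ℤ.* (+ 1 ℤ.* shift (suc m) (negBin (suc m)) k))

altSum-0ˡ : ∀ m i → altSum m 0 i ≡ + 0
altSum-0ˡ m i = Σ<-zero m λ h _ → lem (sgn h) (+ suc h) (+ ((i + m) C (m ∸ suc h)))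
  where
  lem : ∀ s H v → s ℤ.* (H ℤ.* (v ℤ.* + 0)) ≡ + 0
  lem = solve-∀

-- Absorbing h + 1 into the binomial leaves `suc n` times a coefficient of (1 - t)^n (1 - t)^(-n-1)
-- = 1/(1 - t), and every such coefficient is 1.
altSum-0ʳ : ∀ m k → altSum m (suc k) 0 ≡ + m
altSum-0ʳ zero    k = refl
altSum-0ʳ (suc n) k = begin
  Σ< (suc n) (altTerm (suc n) (suc k) 0)
    ≡⟨ Σ<-cong (suc n) term ⟩
  Σ< (suc n) (λ h → + suc n ℤ.* (+ (n C h) ℤ.* (sgn h ℤ.* shift h (negBin (suc n)) k)))
    ≡⟨ Σ<-* (suc n) (+ suc n) _ ⟩
  + suc n ℤ.* Σ< (suc n) (λ h → + (n C h) ℤ.* (sgn h ℤ.* shift h (negBin (suc n)) k))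
    ≡⟨ cong (ℤ._*_ (+ suc n)) (Σ<-binomial n (λ h → sgn h ℤ.* shift h (negBin (suc n)) k)) ⟩
  + suc n ℤ.* bsum n (λ a _ → sgn a ℤ.* shift a (negBin (suc n)) k)
    ≡⟨ cong (λ t → + suc n ℤ.* bsum n (λ a _ → sgn a ℤ.* shift a (negBin t) k)) (+-comm 1 n) ⟩
  + suc n ℤ.* bsum n (λ a _ → sgn a ℤ.* shift a (negBin (n + 1)) k)
    ≡⟨ cong (ℤ._*_ (+ suc n)) (trans (bsum-negBin n 1 k) (negBin-1 k)) ⟩
  + suc n ℤ.* + 1
    ≡⟨ ℤₚ.*-identityʳ _ ⟩
  + suc n ∎
  where
  lem₁ : ∀ s H v u → s ℤ.* (H ℤ.* (v ℤ.* u)) ≡ (H ℤ.* v) ℤ.* (s ℤ.* u)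
  lem₁ = solve-∀
  absorb : ∀ h → h < suc n → + suc h ℤ.* + (suc n C (n ∸ h)) ≡ + suc n ℤ.* + (n C h)
  absorb h h<1+n = begin
    + suc h ℤ.* + (suc n C (n ∸ h))   ≡⟨ cong (λ t → + suc h ℤ.* + t) (nCk≡nC[n∸k] h<1+n) ⟨
    + suc h ℤ.* + (suc n C suc h)     ≡⟨ ℤₚ.pos-* (suc h) (suc n C suc h) ⟨
    + (suc h * (suc n C suc h))       ≡⟨ cong +_ (C-absorb n h) ⟩
    + (suc n * (n C h))               ≡⟨ ℤₚ.pos-* (suc n) (n C h) ⟩
    + suc n ℤ.* + (n C h)             ∎
  term : ∀ h → h < suc n → altTerm (suc n) (suc k) 0 h
       ≡ + suc n ℤ.* (+ (n C h) ℤ.* (sgn h ℤ.* shift h (negBin (suc n)) k))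
  term h h<1+n = begin
    sgn h ℤ.* (+ suc h ℤ.* (+ (suc n C (n ∸ h)) ℤ.* shift (suc h) (negBin (suc n)) (suc k)))
      ≡⟨ lem₁ (sgn h) (+ suc h) (+ (suc n C (n ∸ h))) _ ⟩
    (+ suc h ℤ.* + (suc n C (n ∸ h))) ℤ.* (sgn h ℤ.* shift (suc h) (negBin (suc n)) (suc k))
      ≡⟨ cong₂ (λ x y → x ℤ.* (sgn h ℤ.* y)) (absorb h h<1+n) (shift-suc h (negBin (suc n)) k) ⟩
    (+ suc n ℤ.* + (n C h)) ℤ.* (sgn h ℤ.* shift h (negBin (suc n)) k)
      ≡⟨ ℤₚ.*-assoc (+ suc n) (+ (n C h)) _ ⟩
    + suc n ℤ.* (+ (n C h) ℤ.* (sgn h ℤ.* shift h (negBin (suc n)) k)) ∎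

-- For k, i > 0, posSum m k i = Σ_{s<m} (m - s) C(k-1+s,s) C(i-1+s,s); the values at
-- k = 0 and i = 0 are those making posSum satisfy the recurrence altSum-rec.
coeffˡ coeffʳ : ℕ → ℕ → ℤ
coeffˡ s       zero    = + 0
coeffˡ s       (suc k) = + ((k + s) C s)
coeffʳ zero    zero    = + 1
coeffʳ (suc s) zero    = + 0
coeffʳ s       (suc i) = + ((i + s) C s)

posSum : ℕ → ℕ → ℕ → ℤ
posSum m k i = Σ< m (λ s → + (m ∸ s) ℤ.* (coeffˡ s k ℤ.* coeffʳ s i))

coeffˡ-step : ∀ s k → coeffˡ (suc s) (suc k) ≡ coeffˡ (suc s) k ℤ.+ coeffˡ s (suc k)
coeffˡ-step s zero    = cong +_ (trans (nCn≡1 (suc s)) (sym (nCn≡1 s)))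
coeffˡ-step s (suc k) = cong +_ (begin
  suc (k + suc s) C suc s                 ≡⟨ pascal (k + suc s) s ⟩
  (k + suc s) C s + (k + suc s) C suc s   ≡⟨ +-comm ((k + suc s) C s) _ ⟩
  (k + suc s) C suc s + (k + suc s) C s   ≡⟨ cong (λ t → (k + suc s) C suc s + t C s) (+-suc k s) ⟩
  (k + suc s) C suc s + (suc k + s) C s   ∎)

coeffʳ-suc : ∀ s i → coeffʳ s (suc i) ≡ coeffˡ s (suc i)
coeffʳ-suc zero    i = refl
coeffʳ-suc (suc s) i = refl

coeffʳ-step : ∀ s i → coeffʳ (suc s) (suc i) ≡ coeffʳ (suc s) i ℤ.+ coeffʳ s (suc i)
coeffʳ-step s zero    = trans (coeffˡ-step s 0) (cong (ℤ._+_ (+ 0)) (sym (coeffʳ-suc s 0)))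
coeffʳ-step s (suc i) = trans (coeffˡ-step s (suc i)) (cong (ℤ._+_ (coeffˡ (suc s) (suc i))) (sym (coeffʳ-suc s (suc i))))

coeffʳ-0 : ∀ i → coeffʳ 0 i ≡ + 1
coeffʳ-0 zero    = refl
coeffʳ-0 (suc i) = refl

-- The same mixed difference of products, except that taking differences lowers `s`: summand `s + 1`
-- for `suc m` and summand `s` for `m` carry the same weight m - s. The summand s = 0 does not vary
-- with `i` and drops out.
posSum-rec : ∀ m k i →
  posSum (suc m) (suc k) (suc i) ℤ.+ posSum (suc m) k i
    ≡ (posSum (suc m) k (suc i) ℤ.+ posSum (suc m) (suc k) i) ℤ.+ posSum m (suc k) (suc i)
posSum-rec m k i = begin
  posSum (suc m) (suc k) (suc i) ℤ.+ posSum (suc m) k i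
    ≡⟨ cong₂ ℤ._+_ (split 1 1) (split 0 0) ⟩
  (hd 1 ℤ.+ Σ< m (t 1 1)) ℤ.+ (hd 0 ℤ.+ Σ< m (t 0 0))
    ≡⟨ +-interchange (hd 1) (Σ< m (t 1 1)) (hd 0) (Σ< m (t 0 0)) ⟩
  (hd 1 ℤ.+ hd 0) ℤ.+ (Σ< m (t 1 1) ℤ.+ Σ< m (t 0 0))
    ≡⟨ cong (ℤ._+_ (hd 1 ℤ.+ hd 0)) tails ⟩
  (hd 1 ℤ.+ hd 0) ℤ.+ ((Σ< m (t 0 1) ℤ.+ Σ< m (t 1 0)) ℤ.+ posSum m (suc k) (suc i))
    ≡⟨ rearrange (hd 1) (hd 0) (Σ< m (t 0 1)) (Σ< m (t 1 0)) (posSum m (suc k) (suc i)) ⟩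
  ((hd 0 ℤ.+ Σ< m (t 0 1)) ℤ.+ (hd 1 ℤ.+ Σ< m (t 1 0))) ℤ.+ posSum m (suc k) (suc i)
    ≡⟨ cong (ℤ._+ posSum m (suc k) (suc i)) (cong₂ ℤ._+_ (split 0 1) (split 1 0)) ⟨
  (posSum (suc m) k (suc i) ℤ.+ posSum (suc m) (suc k) i) ℤ.+ posSum m (suc k) (suc i) ∎
  where
  t : ℕ → ℕ → ℕ → ℤ
  t x y s = + (m ∸ s) ℤ.* (coeffˡ (suc s) (x + k) ℤ.* coeffʳ (suc s) (y + i))
  hd : ℕ → ℤ
  hd x = + suc m ℤ.* (coeffˡ 0 (x + k) ℤ.* + 1)
  split : ∀ x y → posSum (suc m) (x + k) (y + i) ≡ hd x ℤ.+ Σ< m (t x y)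
  split x y = trans (Σ<-head m (λ s → + (suc m ∸ s) ℤ.* (coeffˡ s (x + k) ℤ.* coeffʳ s (y + i))))
    (cong (λ c → + suc m ℤ.* (coeffˡ 0 (x + k) ℤ.* c) ℤ.+ Σ< m (t x y)) (coeffʳ-0 (y + i)))
  rearrange : ∀ a b c d e → (a ℤ.+ b) ℤ.+ ((c ℤ.+ d) ℤ.+ e) ≡ ((b ℤ.+ c) ℤ.+ (a ℤ.+ d)) ℤ.+ e
  rearrange = solve-∀
  identity : ∀ w a a′ b b′ →
    w ℤ.* ((a ℤ.+ a′) ℤ.* (b ℤ.+ b′)) ℤ.+ w ℤ.* (a ℤ.* b)
      ≡ (w ℤ.* (a ℤ.* (b ℤ.+ b′)) ℤ.+ w ℤ.* ((a ℤ.+ a′) ℤ.* b)) ℤ.+ w ℤ.* (a′ ℤ.* b′)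
  identity = solve-∀
  expand : ∀ w a a′ b b′ {a₁ b₁} → a₁ ≡ a ℤ.+ a′ → b₁ ≡ b ℤ.+ b′ →
    w ℤ.* (a₁ ℤ.* b₁) ℤ.+ w ℤ.* (a ℤ.* b)
      ≡ (w ℤ.* (a ℤ.* b₁) ℤ.+ w ℤ.* (a₁ ℤ.* b)) ℤ.+ w ℤ.* (a′ ℤ.* b′)
  expand w a a′ b b′ refl refl = identity w a a′ b b′
  p : ℕ → ℤ
  p s = + (m ∸ s) ℤ.* (coeffˡ s (suc k) ℤ.* coeffʳ s (suc i))
  term : ∀ s → s < m → t 1 1 s ℤ.+ t 0 0 s ≡ (t 0 1 s ℤ.+ t 1 0 s) ℤ.+ p s
  term s _ = expand (+ (m ∸ s)) (coeffˡ (suc s) k) (coeffˡ s (suc k)) (coeffʳ (suc s) i) (coeffʳ s (suc i))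
    (coeffˡ-step s k) (coeffʳ-step s i)
  tails : Σ< m (t 1 1) ℤ.+ Σ< m (t 0 0) ≡ (Σ< m (t 0 1) ℤ.+ Σ< m (t 1 0)) ℤ.+ posSum m (suc k) (suc i)
  tails = begin
    Σ< m (t 1 1) ℤ.+ Σ< m (t 0 0)                        ≡⟨ Σ<-+ m (t 1 1) (t 0 0) ⟨
    Σ< m (λ s → t 1 1 s ℤ.+ t 0 0 s)                     ≡⟨ Σ<-cong m term ⟩
    Σ< m (λ s → (t 0 1 s ℤ.+ t 1 0 s) ℤ.+ p s)           ≡⟨ Σ<-+ m (λ s → t 0 1 s ℤ.+ t 1 0 s) p ⟩
    Σ< m (λ s → t 0 1 s ℤ.+ t 1 0 s) ℤ.+ Σ< m p          ≡⟨ cong (ℤ._+ Σ< m p) (Σ<-+ m (t 0 1) (t 1 0)) ⟩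
    (Σ< m (t 0 1) ℤ.+ Σ< m (t 1 0)) ℤ.+ Σ< m p           ∎

posSum-0ˡ : ∀ m i → posSum m 0 i ≡ + 0
posSum-0ˡ m i = Σ<-zero m λ s _ → ℤₚ.*-zeroʳ (+ (m ∸ s))

posSum-0ʳ : ∀ m k → posSum m (suc k) 0 ≡ + m
posSum-0ʳ zero    k = refl
posSum-0ʳ (suc m) k = begin
  posSum (suc m) (suc k) 0
    ≡⟨ Σ<-head m (λ s → + (suc m ∸ s) ℤ.* (coeffˡ s (suc k) ℤ.* coeffʳ s 0)) ⟩
  + suc m ℤ.* + 1 ℤ.+ Σ< m (λ s → + (m ∸ s) ℤ.* (coeffˡ (suc s) (suc k) ℤ.* + 0))
    ≡⟨ cong₂ ℤ._+_ (ℤₚ.*-identityʳ (+ suc m)) (Σ<-zero m λ s _ → lem (+ (m ∸ s)) (coeffˡ (suc s) (suc k))) ⟩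
  + suc m ℤ.+ + 0
    ≡⟨ ℤₚ.+-identityʳ _ ⟩
  + suc m ∎
  where
  lem : ∀ w c → w ℤ.* (c ℤ.* + 0) ≡ + 0
  lem = solve-∀

posSum-comm : ∀ m k i → posSum m (suc k) (suc i) ≡ posSum m (suc i) (suc k)
posSum-comm m k i = Σ<-cong m λ s _ → cong (ℤ._*_ (+ (m ∸ s)))
  (trans (ℤₚ.*-comm (coeffˡ s (suc k)) (coeffʳ s (suc i)))
         (cong₂ ℤ._*_ (coeffʳ-suc s i) (sym (coeffʳ-suc s k))))

-- Both sides have the same mixed second difference in (k , i) and the same boundary values.
altSum≡posSum : ∀ m k i → altSum m k i ≡ posSum m k i
altSum≡posSum zero    k       i       = refl
altSum≡posSum (suc m) zero    i       = trans (altSum-0ˡ (suc m) i) (sym (posSum-0ˡ (suc m) i))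
altSum≡posSum (suc m) (suc k) zero    = trans (altSum-0ʳ (suc m) k) (sym (posSum-0ʳ (suc m) k))
altSum≡posSum (suc m) (suc k) (suc i) = ∙-cancelʳ (altSum (suc m) k i) _ _ (begin
  altSum (suc m) (suc k) (suc i) ℤ.+ altSum (suc m) k i
    ≡⟨ altSum-rec m k i ⟩
  (altSum (suc m) k (suc i) ℤ.+ altSum (suc m) (suc k) i) ℤ.+ altSum m (suc k) (suc i)
    ≡⟨ cong₂ ℤ._+_ (cong₂ ℤ._+_ (altSum≡posSum (suc m) k (suc i)) (altSum≡posSum (suc m) (suc k) i)) (altSum≡posSum m (suc k) (suc i)) ⟩
  (posSum (suc m) k (suc i) ℤ.+ posSum (suc m) (suc k) i) ℤ.+ posSum m (suc k) (suc i)
    ≡⟨ posSum-rec m k i ⟨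
  posSum (suc m) (suc k) (suc i) ℤ.+ posSum (suc m) k i
    ≡⟨ cong (ℤ._+_ (posSum (suc m) (suc k) (suc i))) (altSum≡posSum (suc m) k i) ⟨
  posSum (suc m) (suc k) (suc i) ℤ.+ altSum (suc m) k i ∎)
  where
  open import Algebra.Properties.AbelianGroup ℤₚ.+-0-abelianGroup using (∙-cancelʳ)

altSum-comm : ∀ m k i → altSum m (suc k) (suc i) ≡ altSum m (suc i) (suc k)
altSum-comm m k i = begin
  altSum m (suc k) (suc i) ≡⟨ altSum≡posSum m (suc k) (suc i) ⟩
  posSum m (suc k) (suc i) ≡⟨ posSum-comm m k i ⟩
  posSum m (suc i) (suc k) ≡⟨ altSum≡posSum m (suc i) (suc k) ⟨
  altSum m (suc i) (suc k) ∎

-- The polynomial form of the alternating sum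

C-factorial : ∀ a b → ((a + b) C a) * (a ! * b !) ≡ (a + b) !
C-factorial a b = begin
  ((a + b) C a) * (a ! * b !)             ≡⟨ cong (λ t → ((a + b) C a) * (a ! * t !)) (m+n∸m≡n a b) ⟨
  ((a + b) C a) * (a ! * (a + b ∸ a) !)   ≡⟨ cong (_* (a ! * (a + b ∸ a) !)) (nCk≡n!/k![n-k]! (m≤m+n a b)) ⟩
  _                                       ≡⟨ m/n*n≡m {{a !* (a + b ∸ a) !≢0}} (k![n∸k]!∣n! (m≤m+n a b)) ⟩
  (a + b) !                               ∎

C-factorial′ : ∀ {n} a b → a + b ≡ n → (n C a) * (a ! * b !) ≡ n !
C-factorial′ a b refl = C-factorial a b

C-complement : ∀ {n} a b → a + b ≡ n → n C a ≡ n C b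
C-complement a b refl = trans (nCk≡nC[n∸k] (m≤m+n a b)) (cong ((a + b) C_) (m+n∸m≡n a b))

C-nonZero : ∀ a b → NonZero ((a + b) C a)
C-nonZero a b = m*n≢0⇒m≢0 ((a + b) C a) {{subst NonZero (sym (C-factorial a b)) ((a + b) !≢0)}}

-- Both sides equal the same quotient of factorials.
C-exchange : ∀ h p r i → let k = suc h + p; m = suc h + r in
  m * ((k + i + 2 * m) C m) * ((m + (k + i)) C i) * (((h + p + r) C r) * ((k + i) C p))
    ≡ k * ((k + i + 2 * m) C (i + m)) * ((k + i) C i) * (((i + m) C r) * ((p + (h + r)) C (h + r)))
C-exchange h p r i = *-cancelʳ-≡ _ _ T {{T≢0}} (begin
  m * C₁ * C₂ * (C₃ * C₄) * T
    ≡⟨ regroupˡ m C₁ C₂ C₃ C₄ ((h + r) !) (n !) (i !) ((m + k) !) (r !) ((h + p) !) (p !) ((suc h + i) !) ⟩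
  C₁ * (m ! * n !) * (C₂ * (i ! * (m + k) !)) * (C₃ * (r ! * (h + p) !)) * (C₄ * (p ! * (suc h + i) !))
    ≡⟨ cong₂ _*_ (cong₂ _*_ (cong₂ _*_
         (trans (C-factorial′ m n (e₁ m k i)) (sym (C-factorial′ (i + m) (m + k) (e₂ m k i))))
         (C-factorial′ i (m + k) (e₃ m k i)))
         (trans (C-factorial′ r (h + p) (+-comm r (h + p)))
                (trans (cong _! (e₄ h p r)) (sym (C-factorial′ (h + r) p (+-comm (h + r) p))))))
         (trans (C-factorial′ p (suc h + i) (e₅ h p i)) (sym (C-factorial′ i k (+-comm i k)))) ⟩
  D₁ * ((i + m) ! * (m + k) !) * n ! * (D₄ * ((h + r) ! * p !)) * (D₂ * (i ! * k !))
    ≡⟨ cong (λ t → D₁ * (t * (m + k) !) * n ! * (D₄ * ((h + r) ! * p !)) * (D₂ * (i ! * k !)))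
            (C-factorial′ r (suc h + i) (e₆ h r i)) ⟨
  D₁ * (D₃ * (r ! * (suc h + i) !) * (m + k) !) * n ! * (D₄ * ((h + r) ! * p !)) * (D₂ * (i ! * k !))
    ≡⟨ regroupʳ k D₁ D₂ D₃ D₄ ((h + r) !) (n !) (i !) ((m + k) !) (r !) ((h + p) !) (p !) ((suc h + i) !) ⟩
  k * D₁ * D₂ * (D₃ * D₄) * T ∎)
  where
  k = suc h + p
  m = suc h + r
  n = m + (k + i)
  C₁ = (k + i + 2 * m) C m
  C₂ = n C i
  C₃ = (h + p + r) C r
  C₄ = (k + i) C p
  D₁ = (k + i + 2 * m) C (i + m)
  D₂ = (k + i) C i
  D₃ = (i + m) C r
  D₄ = (p + (h + r)) C (h + r)
  -- The denominators of the four binomials on the left, except that `m !` is split as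
  -- `m * (h + r) !` to use up the factor `m`. On the right the factor `k` joins `(h + p) !` to form
  -- `k !`.
  T = (h + r) ! * n ! * (i ! * (m + k) !) * (r ! * (h + p) !) * (p ! * (suc h + i) !)
  T≢0 : NonZero T
  T≢0 = m*n≢0 ((h + r) ! * n ! * (i ! * (m + k) !) * (r ! * (h + p) !)) (p ! * (suc h + i) !)
    {{m*n≢0 ((h + r) ! * n ! * (i ! * (m + k) !)) (r ! * (h + p) !)
      {{m*n≢0 ((h + r) ! * n !) (i ! * (m + k) !) {{(h + r) !* n !≢0}} {{i !* (m + k) !≢0}}}} {{r !* (h + p) !≢0}}}}
    {{p !* (suc h + i) !≢0}}
  e₁ : ∀ m k i → m + (m + (k + i)) ≡ k + i + 2 * m
  e₁ = ℕ-Solver.solve-∀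
  e₂ : ∀ m k i → (i + m) + (m + k) ≡ k + i + 2 * m
  e₂ = ℕ-Solver.solve-∀
  e₃ : ∀ m k i → i + (m + k) ≡ m + (k + i)
  e₃ = ℕ-Solver.solve-∀
  e₄ : ∀ h p r → h + p + r ≡ p + (h + r)
  e₄ = ℕ-Solver.solve-∀
  e₅ : ∀ h p i → p + (suc h + i) ≡ suc h + p + i
  e₅ = ℕ-Solver.solve-∀
  e₆ : ∀ h r i → r + (suc h + i) ≡ i + (suc h + r)
  e₆ = ℕ-Solver.solve-∀
  regroupˡ : ∀ m C₁ C₂ C₃ C₄ a b c d e f g h →
    m * C₁ * C₂ * (C₃ * C₄) * (a * b * (c * d) * (e * f) * (g * h))
      ≡ C₁ * ((m * a) * b) * (C₂ * (c * d)) * (C₃ * (e * f)) * (C₄ * (g * h))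
  regroupˡ = ℕ-Solver.solve-∀
  regroupʳ : ∀ k D₁ D₂ D₃ D₄ a b c d e f g h →
    D₁ * (D₃ * (e * h) * d) * b * (D₄ * (a * g)) * (D₂ * (c * (k * f)))
      ≡ k * D₁ * D₂ * (D₃ * D₄) * (a * b * (c * d) * (e * f) * (g * h))
  regroupʳ = ℕ-Solver.solve-∀

polyTerm : ℕ → ℕ → ℕ → ℕ → ℤ
polyTerm m κ l h =
  sgn h ℤ.* (+ suc h ℤ.* (+ ((κ + (m ∸ suc h)) C (m ∸ suc h)) ℤ.* shift (suc h) (λ c → + ((suc κ + l) C c)) (suc κ)))

-- With k = suc κ, this is altSum m k l rescaled to a polynomial in l of degree less than k.
polySum : ℕ → ℕ → ℕ → ℤ
polySum m κ l = Σ< m (polyTerm m κ l)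

-- An n-th finite difference of a polynomial in `a` of degree c < n; by Pascal each single
-- difference lowers `c` by one.
bsum-C : ∀ n x c → c < n → bsum n (λ j a → sgn j ℤ.* + ((x + a) C c)) ≡ + 0
bsum-C (suc n) x zero    _         = trans (sym (bsum-+ n _ _)) (bsum-zero n λ j _ _ → lem (sgn j))
  where
  lem : ∀ s → (- s) ℤ.* + 1 ℤ.+ s ℤ.* + 1 ≡ + 0
  lem = solve-∀
bsum-C (suc n) x (suc c) (s≤s c<n) = begin
  bsum n (λ j a → (- sgn j) ℤ.* + ((x + a) C suc c)) ℤ.+ bsum n (λ j a → sgn j ℤ.* + ((x + suc a) C suc c))
    ≡⟨ bsum-+ n _ _ ⟨
  bsum n (λ j a → (- sgn j) ℤ.* + ((x + a) C suc c) ℤ.+ sgn j ℤ.* + ((x + suc a) C suc c))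
    ≡⟨ bsum-cong n (λ j a _ → trans
         (cong (λ t → (- sgn j) ℤ.* + ((x + a) C suc c) ℤ.+ sgn j ℤ.* + t)
               (trans (cong (_C suc c) (+-suc x a)) (pascal (x + a) c)))
         (lem (sgn j) (+ ((x + a) C suc c)) (+ ((x + a) C c)))) ⟩
  bsum n (λ j a → sgn j ℤ.* + ((x + a) C c))
    ≡⟨ bsum-C n x c c<n ⟩
  + 0 ∎
  where
  lem : ∀ s u v → (- s) ℤ.* u ℤ.+ s ℤ.* (v ℤ.+ u) ≡ s ℤ.* v
  lem = solve-∀

-- In `a`, a nonzero summand is a constant times C(κ+1+a, κ-h), of degree at most κ.
bsum-polySum : ∀ n m κ → κ < n → bsum n (λ j a → sgn j ℤ.* polySum m κ a) ≡ + 0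
bsum-polySum n m κ κ<n = begin
  bsum n (λ j a → sgn j ℤ.* polySum m κ a)
    ≡⟨ bsum-cong n (λ j a _ → sym (Σ<-* m (sgn j) (polyTerm m κ a))) ⟩
  bsum n (λ j a → Σ< m (λ h → sgn j ℤ.* polyTerm m κ a h))
    ≡⟨ bsum-Σ< n m (λ j a h → sgn j ℤ.* polyTerm m κ a h) ⟩
  Σ< m (λ h → bsum n (λ j a → sgn j ℤ.* polyTerm m κ a h))
    ≡⟨ Σ<-zero m (λ h _ → term h) ⟩
  + 0 ∎
  where
  pull : ∀ x s H v u → x ℤ.* (s ℤ.* (H ℤ.* (v ℤ.* u))) ≡ (s ℤ.* (H ℤ.* v)) ℤ.* (x ℤ.* u)
  pull = solve-∀
  inner : ∀ h → bsum n (λ j a → sgn j ℤ.* shift (suc h) (λ c → + ((suc κ + a) C c)) (suc κ)) ≡ + 0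
  inner h with h ≤? κ
  ... | yes h≤κ = trans
    (bsum-cong n λ j a _ → cong (ℤ._*_ (sgn j)) (shift-≥ (suc h) (λ c → + ((suc κ + a) C c)) (suc κ) (s≤s h≤κ)))
    (bsum-C n (suc κ) (κ ∸ h) (≤-<-trans (m∸n≤m κ h) κ<n))
  ... | no  h≰κ = bsum-zero n λ j a _ → trans
    (cong (ℤ._*_ (sgn j)) (shift-< (suc h) (λ c → + ((suc κ + a) C c)) (suc κ) (s≤s (≰⇒> h≰κ))))
    (ℤₚ.*-zeroʳ (sgn j))
  term : ∀ h → bsum n (λ j a → sgn j ℤ.* polyTerm m κ a h) ≡ + 0
  term h = begin
    bsum n (λ j a → sgn j ℤ.* polyTerm m κ a h)
      ≡⟨ bsum-cong n (λ j a _ → pull (sgn j) (sgn h) (+ suc h) (+ ((κ + (m ∸ suc h)) C (m ∸ suc h))) _) ⟩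
    bsum n (λ j a → c ℤ.* (sgn j ℤ.* shift (suc h) (λ c → + ((suc κ + a) C c)) (suc κ)))
      ≡⟨ bsum-* n c _ ⟩
    c ℤ.* bsum n (λ j a → sgn j ℤ.* shift (suc h) (λ c → + ((suc κ + a) C c)) (suc κ))
      ≡⟨ cong (ℤ._*_ c) (inner h) ⟩
    c ℤ.* + 0
      ≡⟨ ℤₚ.*-zeroʳ c ⟩
    + 0 ∎
    where c = sgn h ℤ.* (+ suc h ℤ.* + ((κ + (m ∸ suc h)) C (m ∸ suc h)))

-- The two outer constants do not involve h, so the identity holds summand by summand through
-- `C-exchange`.
polySum-altSum : ∀ m κ i → let k = suc κ in
  + (m * ((k + i + 2 * m) C m) * ((m + (k + i)) C i)) ℤ.* polySum m κ i
    ≡ + (k * ((k + i + 2 * m) C (i + m)) * ((k + i) C i)) ℤ.* altSum m k i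
polySum-altSum m κ i = begin
  + K₁ m κ ℤ.* polySum m κ i
    ≡⟨ Σ<-* m (+ K₁ m κ) (polyTerm m κ i) ⟨
  Σ< m (λ h → + K₁ m κ ℤ.* polyTerm m κ i h)
    ≡⟨ Σ<-cong m (λ h h<m → begin
         + K₁ m κ ℤ.* polyTerm m κ i h
           ≡⟨ pull (+ K₁ m κ) (sgn h) (+ suc h) _ ⟩
         sgn h ℤ.* (+ suc h ℤ.* (+ K₁ m κ ℤ.* lhs m κ h))
           ≡⟨ cong (λ t → sgn h ℤ.* (+ suc h ℤ.* t)) (core m κ h h<m) ⟩
         sgn h ℤ.* (+ suc h ℤ.* (+ K₂ m κ ℤ.* rhs m κ h))
           ≡⟨ pull (+ K₂ m κ) (sgn h) (+ suc h) _ ⟨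
         + K₂ m κ ℤ.* altTerm m (suc κ) i h ∎) ⟩
  Σ< m (λ h → + K₂ m κ ℤ.* altTerm m (suc κ) i h)
    ≡⟨ Σ<-* m (+ K₂ m κ) (altTerm m (suc κ) i) ⟩
  + K₂ m κ ℤ.* altSum m (suc κ) i ∎
  where
  K₁ K₂ : ℕ → ℕ → ℕ
  K₁ m κ = m * ((suc κ + i + 2 * m) C m) * ((m + (suc κ + i)) C i)
  K₂ m κ = suc κ * ((suc κ + i + 2 * m) C (i + m)) * ((suc κ + i) C i)
  lhs rhs : ℕ → ℕ → ℕ → ℤ
  lhs m κ h = + ((κ + (m ∸ suc h)) C (m ∸ suc h)) ℤ.* shift (suc h) (λ c → + ((suc κ + i) C c)) (suc κ)
  rhs m κ h = + ((i + m) C (m ∸ suc h)) ℤ.* shift (suc h) (negBin m) (suc κ)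
  pull : ∀ x s H v → x ℤ.* (s ℤ.* (H ℤ.* v)) ≡ s ℤ.* (H ℤ.* (x ℤ.* v))
  pull = solve-∀
  lhs-+ : ∀ h p r → lhs (suc h + r) (h + p) h ≡ + (((h + p + r) C r) * ((suc h + p + i) C p))
  lhs-+ h p r = begin
    lhs (suc h + r) (h + p) h
      ≡⟨ cong₂ (λ x y → + ((h + p + x) C x) ℤ.* y) (m+n∸m≡n h r)
               (shift-+ (suc h) (λ c → + ((suc (h + p) + i) C c)) p) ⟩
    + ((h + p + r) C r) ℤ.* + ((suc h + p + i) C p)
      ≡⟨ ℤₚ.pos-* ((h + p + r) C r) _ ⟨
    + (((h + p + r) C r) * ((suc h + p + i) C p)) ∎
  rhs-+ : ∀ h p r → rhs (suc h + r) (h + p) h ≡ + (((i + (suc h + r)) C r) * ((p + (h + r)) C (h + r)))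
  rhs-+ h p r = begin
    rhs (suc h + r) (h + p) h
      ≡⟨ cong₂ (λ x y → + ((i + (suc h + r)) C x) ℤ.* y) (m+n∸m≡n h r)
               (trans (shift-+ (suc h) (negBin (suc h + r)) p) (negBin-C (h + r) p)) ⟩
    + ((i + (suc h + r)) C r) ℤ.* + ((p + (h + r)) C (h + r))
      ≡⟨ ℤₚ.pos-* ((i + (suc h + r)) C r) _ ⟨
    + (((i + (suc h + r)) C r) * ((p + (h + r)) C (h + r))) ∎
  core-+ : ∀ h p r → + K₁ (suc h + r) (h + p) ℤ.* lhs (suc h + r) (h + p) h
                   ≡ + K₂ (suc h + r) (h + p) ℤ.* rhs (suc h + r) (h + p) h
  core-+ h p r = begin
    + K₁ (suc h + r) (h + p) ℤ.* lhs (suc h + r) (h + p) h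
      ≡⟨ cong (ℤ._*_ (+ K₁ (suc h + r) (h + p))) (lhs-+ h p r) ⟩
    + K₁ (suc h + r) (h + p) ℤ.* + (((h + p + r) C r) * ((suc h + p + i) C p))
      ≡⟨ ℤₚ.pos-* (K₁ (suc h + r) (h + p)) _ ⟨
    + (K₁ (suc h + r) (h + p) * (((h + p + r) C r) * ((suc h + p + i) C p)))
      ≡⟨ cong +_ (C-exchange h p r i) ⟩
    + (K₂ (suc h + r) (h + p) * (((i + (suc h + r)) C r) * ((p + (h + r)) C (h + r))))
      ≡⟨ ℤₚ.pos-* (K₂ (suc h + r) (h + p)) _ ⟩
    + K₂ (suc h + r) (h + p) ℤ.* + (((i + (suc h + r)) C r) * ((p + (h + r)) C (h + r)))
      ≡⟨ cong (ℤ._*_ (+ K₂ (suc h + r) (h + p))) (rhs-+ h p r) ⟨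
    + K₂ (suc h + r) (h + p) ℤ.* rhs (suc h + r) (h + p) h ∎
  -- For h ≤ κ, writing κ = h + p and m = h + 1 + r turns the truncated subtractions into sums; for
  -- h > κ the `shift` kills both sides.
  core : ∀ m κ h → h < m → + K₁ m κ ℤ.* lhs m κ h ≡ + K₂ m κ ℤ.* rhs m κ h
  core m κ h h<m with h ≤? κ
  ... | yes h≤κ = subst₂ (λ m κ → + K₁ m κ ℤ.* lhs m κ h ≡ + K₂ m κ ℤ.* rhs m κ h)
                    (m+[n∸m]≡n h<m) (m+[n∸m]≡n h≤κ) (core-+ h (κ ∸ h) (m ∸ suc h))
  ... | no  h≰κ = trans (vanish (+ K₁ m κ) (+ ((κ + (m ∸ suc h)) C (m ∸ suc h)))
                      (shift-< (suc h) (λ c → + ((suc κ + i) C c)) (suc κ) (s≤s (≰⇒> h≰κ))))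
                    (sym (vanish (+ K₂ m κ) (+ ((i + m) C (m ∸ suc h)))
                      (shift-< (suc h) (negBin m) (suc κ) (s≤s (≰⇒> h≰κ)))))
    where
    vanish : ∀ a b {c} → c ≡ + 0 → a ℤ.* (b ℤ.* c) ≡ + 0
    vanish a b refl = trans (cong (ℤ._*_ a) (ℤₚ.*-zeroʳ b)) (ℤₚ.*-zeroʳ a)

-- Here the d of the theorem is `suc k + i`; the number called k elsewhere is `suc k`.
sumFrom1-altSum : ∀ m k i →
  sumFrom1 m (λ h → sgn (suc h) ℤ.* (+ (h * ((i + m) C (m ∸ h)) * (((suc k + i + m) ∸ (i + h + 1)) C (m ∸ 1)))))
    ≡ altSum m (suc k) i
sumFrom1-altSum m k i = trans (sumℤ-upTo m _) (Σ<-cong m (term m))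
  where
  top : ∀ k i m h → (suc k + i + suc m) ∸ (i + suc h + 1) ≡ (k + m) ∸ h
  top k i m h = begin
    (suc k + i + suc m) ∸ (i + suc h + 1)      ≡⟨ cong₂ _∸_ (e₁ k i m) (e₂ i h) ⟩
    ((i + 2) + (k + m)) ∸ ((i + 2) + h)        ≡⟨ [m+n]∸[m+o]≡n∸o (i + 2) (k + m) h ⟩
    (k + m) ∸ h                                ∎
    where
    e₁ : ∀ k i m → suc k + i + suc m ≡ (i + 2) + (k + m)
    e₁ = ℕ-Solver.solve-∀
    e₂ : ∀ i h → i + suc h + 1 ≡ (i + 2) + h
    e₂ = ℕ-Solver.solve-∀
  factor : ∀ m h → h < suc m → + ((k + m ∸ h) C m) ≡ shift (suc h) (negBin (suc m)) (suc k)
  factor m h h<1+m with h ≤? k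
  ... | yes h≤k = begin
    + ((k + m ∸ h) C m)                       ≡⟨ cong (λ t → + (t C m)) (+-∸-comm m h≤k) ⟩
    + ((k ∸ h + m) C m)                       ≡⟨ negBin-C m (k ∸ h) ⟨
    negBin (suc m) (k ∸ h)                    ≡⟨ shift-≥ (suc h) (negBin (suc m)) (suc k) (s≤s h≤k) ⟨
    shift (suc h) (negBin (suc m)) (suc k)    ∎
  ... | no  h≰k = trans (cong +_ (k>n⇒nCk≡0 small)) (sym (shift-< (suc h) (negBin (suc m)) (suc k) (s≤s (≰⇒> h≰k))))
    where
    -- The bound h ≤ m keeps this subtraction from truncating. A truncated top entry 0 over the
    -- lower entry m = 0 would give 1 instead of the required 0.
    small : k + m ∸ h < m
    small = subst (k + m ∸ h <_) (m+n∸m≡n h m) (∸-monoˡ-< (+-monoˡ-< m (≰⇒> h≰k)) (≤-trans (≤-pred h<1+m) (m≤n+m m k)))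
  term : ∀ m h → h < m →
    sgn (suc (suc h)) ℤ.* (+ (suc h * ((i + m) C (m ∸ suc h)) * (((suc k + i + m) ∸ (i + suc h + 1)) C (m ∸ 1))))
      ≡ altTerm m (suc k) i h
  term (suc m) h h<m = begin
    sgn (suc (suc h)) ℤ.* + (suc h * v * (((suc k + i + suc m) ∸ (i + suc h + 1)) C m))
      ≡⟨ cong₂ (λ x y → x ℤ.* + (suc h * v * (y C m))) (ℤₚ.neg-involutive (sgn h)) (top k i m h) ⟩
    sgn h ℤ.* + (suc h * v * ((k + m ∸ h) C m))
      ≡⟨ cong (ℤ._*_ (sgn h)) (trans (cong +_ (*-assoc (suc h) v _)) (trans (ℤₚ.pos-* (suc h) _) (cong (ℤ._*_ (+ suc h)) (ℤₚ.pos-* v _)))) ⟩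
    sgn h ℤ.* (+ suc h ℤ.* (+ v ℤ.* + ((k + m ∸ h) C m)))
      ≡⟨ cong (λ t → sgn h ℤ.* (+ suc h ℤ.* (+ v ℤ.* t))) (factor m h h<m) ⟩
    altTerm (suc m) (suc k) i h ∎
    where v = (i + suc m) C (m ∸ h)

-- Binomial multiples as sums over splittings

-- The indicator fixes the size of the second part. In this form a binomial multiple can be
-- rearranged by `bsum-assoc` together with an alternating sum.
bsum-select : ∀ i x (g : ℕ → ℤ) →
  bsum (i + x) (λ a b → monomial (+ 1) x b ℤ.* g a) ≡ + ((i + x) C i) ℤ.* g i
bsum-select zero x g = begin
  bsum x (λ a b → monomial (+ 1) x b ℤ.* g a)
    ≡⟨ bsum-emptyˡ x (λ a b e → cong (ℤ._* g (suc a)) (monomial-off (+ 1) x b λ b≡x → m+1+n≢n a (trans (+-suc a b) (trans e (sym b≡x))))) ⟩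
  monomial (+ 1) x x ℤ.* g 0
    ≡⟨ cong (ℤ._* g 0) (monomial-diag (+ 1) x) ⟩
  + 1 ℤ.* g 0 ∎
bsum-select (suc i) zero g = begin
  bsum (suc i + 0) (λ a b → monomial (+ 1) 0 b ℤ.* g a)
    ≡⟨ bsum-emptyʳ (suc i + 0) {λ a b → monomial (+ 1) 0 b ℤ.* g a} (λ _ _ _ → refl) ⟩
  + 1 ℤ.* g (suc i + 0)
    ≡⟨ cong (λ t → + 1 ℤ.* g t) (+-identityʳ (suc i)) ⟩
  + 1 ℤ.* g (suc i)
    ≡⟨ cong (λ t → + t ℤ.* g (suc i)) (trans (cong (_C suc i) (+-identityʳ (suc i))) (nCn≡1 (suc i))) ⟨
  + ((suc i + 0) C suc i) ℤ.* g (suc i) ∎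
bsum-select (suc i) (suc x) g = begin
  bsum (i + suc x) (λ a b → monomial (+ 1) (suc x) b ℤ.* g (suc a)) ℤ.+ bsum (i + suc x) (λ a b → monomial (+ 1) x b ℤ.* g a)
    ≡⟨ cong₂ ℤ._+_ (bsum-select i (suc x) (λ a → g (suc a)))
         (trans (cong (λ n → bsum n (λ a b → monomial (+ 1) x b ℤ.* g a)) (+-suc i x)) (bsum-select (suc i) x g)) ⟩
  + ((i + suc x) C i) ℤ.* g (suc i) ℤ.+ + ((suc i + x) C suc i) ℤ.* g (suc i)
    ≡⟨ ℤₚ.*-distribʳ-+ (g (suc i)) (+ ((i + suc x) C i)) (+ ((suc i + x) C suc i)) ⟨
  + ((i + suc x) C i + (suc i + x) C suc i) ℤ.* g (suc i)
    ≡⟨ cong (λ t → + ((i + suc x) C i + t C suc i) ℤ.* g (suc i)) (+-suc i x) ⟨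
  + ((i + suc x) C i + (i + suc x) C suc i) ℤ.* g (suc i)
    ≡⟨ cong (λ t → + t ℤ.* g (suc i)) (pascal (i + suc x) i) ⟨
  + ((suc i + suc x) C suc i) ℤ.* g (suc i) ∎

bsum-select-< : ∀ n x (g : ℕ → ℤ) → n < x → bsum n (λ a b → monomial (+ 1) x b ℤ.* g a) ≡ + 0
bsum-select-< n x g n<x = bsum-zero n λ a b e →
  cong (ℤ._* g a) (monomial-off (+ 1) x b λ b≡x → <-irrefl refl (<-≤-trans n<x (subst (_≤ n) b≡x (subst (b ≤_) e (m≤n+m b a)))))

-- The identity C(n,j) C(n-j,x) = C(n,x) C(n-x,j): of three parts, the one of size `x` may be chosen
-- last or first.
bsum-select-alternating : ∀ i x (g : ℕ → ℤ) →
  bsum (i + x) (λ j s → sgn j ℤ.* bsum s (λ a b → monomial (+ 1) x b ℤ.* g a))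
    ≡ + ((i + x) C i) ℤ.* bsum i (λ j a → sgn j ℤ.* g a)
bsum-select-alternating i x g = begin
  bsum (i + x) (λ j s → sgn j ℤ.* bsum s (λ a b → monomial (+ 1) x b ℤ.* g a))
    ≡⟨ bsum-cong (i + x) (λ j s _ → trans (sym (bsum-* s (sgn j) _))
         (bsum-cong s λ a b _ → swap (sgn j) (monomial (+ 1) x b) (g a))) ⟩
  bsum (i + x) (λ j s → bsum s (λ a b → monomial (+ 1) x b ℤ.* (sgn j ℤ.* g a)))
    ≡⟨ bsum-assoc (i + x) (λ j a b → monomial (+ 1) x b ℤ.* (sgn j ℤ.* g a)) ⟩
  bsum (i + x) (λ w b → bsum w (λ j a → monomial (+ 1) x b ℤ.* (sgn j ℤ.* g a)))
    ≡⟨ bsum-cong (i + x) (λ w b _ → bsum-* w (monomial (+ 1) x b) _) ⟩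
  bsum (i + x) (λ w b → monomial (+ 1) x b ℤ.* bsum w (λ j a → sgn j ℤ.* g a))
    ≡⟨ bsum-select i x (λ w → bsum w (λ j a → sgn j ℤ.* g a)) ⟩
  + ((i + x) C i) ℤ.* bsum i (λ j a → sgn j ℤ.* g a) ∎
  where
  swap : ∀ s c g → s ℤ.* (c ℤ.* g) ≡ c ℤ.* (s ℤ.* g)
  swap = solve-∀

-- Palindromicity and inversion of the Z-polynomial

-- Coefficients of Σ_j C(s,j) (t - 1)^j p_{s-j}, the contribution of the proper flats.
properFlats : (ℕ → Poly) → ℕ → Poly
properFlats q s i = bsum s (λ j u → bsum j (λ a b → sgn a ℤ.* shift b (q u) i))

-- The characteristic polynomial of the uniform matroid of corank m on s ≥ m elements.
uniformChar : ℕ → ℕ → Poly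
uniformChar m s i = bsum s (λ a b → sgn a ℤ.* monomial (+ 1) (b ∸ m) i)

-- q s is the Kazhdan–Lusztig polynomial of the uniform matroid of corank m on s elements; the
-- value q s = 0 for s ≤ m removes the subsets F with |E - F| ≤ m from the sums over proper flats.
record IsUniformKL (m N : ℕ) (q : ℕ → Poly) : Set where
  field
    small : ∀ s i → s ≤ m → q s i ≡ + 0
    deg   : ∀ s i → m < s → s ≤ N → s ∸ m ≤ 2 * i → q s i ≡ + 0
    rec   : ∀ s i → m < s → s ≤ N →
            reflect (s ∸ m) (q s) i ≡ properFlats q s i ℤ.+ uniformChar m s i

-- When `q` satisfies `IsUniformKL` and s > m, this is the Z-polynomial minus t^(s-m), the term of
-- the flat `E`.
uniformZ : (ℕ → Poly) → ℕ → Poly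
uniformZ q s i = bsum s (λ j u → shift j (q u) i)

uniformZ-invert : ∀ q s i → bsum s (λ j u → sgn j ℤ.* shift j (uniformZ q u) i) ≡ q s i
uniformZ-invert q s i = begin
  bsum s (λ j u → sgn j ℤ.* shift j (uniformZ q u) i)
    ≡⟨ bsum-cong s (λ j u _ → begin
         sgn j ℤ.* shift j (uniformZ q u) i
           ≡⟨ cong (ℤ._*_ (sgn j)) (shift-bsum j u (λ l v → shift l (q v)) i) ⟩
         sgn j ℤ.* bsum u (λ l v → shift j (shift l (q v)) i)
           ≡⟨ bsum-* u (sgn j) _ ⟨
         bsum u (λ l v → sgn j ℤ.* shift j (shift l (q v)) i)
           ≡⟨ bsum-cong u (λ l v _ → cong (ℤ._*_ (sgn j)) (shift-shift j l (q v) i)) ⟩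
         bsum u (λ l v → sgn j ℤ.* shift (j + l) (q v) i) ∎) ⟩
  bsum s (λ j u → bsum u (λ l v → sgn j ℤ.* shift (j + l) (q v) i))
    ≡⟨ bsum-invertˡ s (λ w v → shift w (q v) i) ⟩
  q s i ∎

-- For a fixed remainder `v`, the factors (t - 1)^l over all splittings of the other `w` elements
-- add up to ((t - 1) + 1)^w = t^w.
properFlats-sum : ∀ q s i → bsum s (λ _ u → properFlats q u i) ≡ uniformZ q s i
properFlats-sum q s i = begin
  bsum s (λ _ u → bsum u (λ l v → bsum l (λ a b → sgn a ℤ.* shift b (q v) i)))
    ≡⟨ bsum-assoc s (λ _ l v → bsum l (λ a b → sgn a ℤ.* shift b (q v) i)) ⟩
  bsum s (λ w v → bsum w (λ _ l → bsum l (λ a b → sgn a ℤ.* shift b (q v) i)))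
    ≡⟨ bsum-cong s (λ w v _ → bsum-invertʳ w (λ b → shift b (q v) i)) ⟩
  bsum s (λ w v → shift w (q v) i) ∎

-- All exponents `b ∸ m` truncate to 0, leaving (1 - 1)^s in degree 0. The nested monomial is the
-- indicator of i = 0 and s = 0, the form in which `palindrome` adds it to the summand of remainder
-- `u`.
uniformChar-≤ : ∀ m s i → s ≤ m → uniformChar m s i ≡ monomial (monomial (+ 1) 0 i) 0 s
uniformChar-≤ m s i s≤m = trans
  (bsum-cong s λ a b e → cong (λ t → sgn a ℤ.* monomial (+ 1) t i) (m≤n⇒m∸n≡0 (≤-trans (subst (b ≤_) e (m≤n+m b a)) s≤m)))
  (collapse s)
  where
  collapse : ∀ s → bsum s (λ a _ → sgn a ℤ.* monomial (+ 1) 0 i) ≡ monomial (monomial (+ 1) 0 i) 0 s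
  collapse zero    = ℤₚ.*-identityˡ _
  collapse (suc s) = bsum-sgnˡ s _

module UniformZ {m N : ℕ} {q : ℕ → Poly} (kl : IsUniformKL m N q) where
  open IsUniformKL kl

  -- Both sides are the coefficient of `p` at l - j = f - i, or 0 when this difference is negative.
  shift-reflect : ∀ p j f l i → j + f ≡ l + i → shift j p l ≡ reflect f p i
  shift-reflect p j f l i e with j ≤? l
  ... | yes j≤l = begin
    shift j p l                     ≡⟨ shift-≥ j p l j≤l ⟩
    p (l ∸ j)                       ≡⟨ reflect-+ p i (l ∸ j) ⟨
    reflect (i + (l ∸ j)) p i       ≡⟨ cong (λ t → reflect t p i) (sym f≡) ⟩
    reflect f p i                   ∎
    where
    f≡ : f ≡ i + (l ∸ j)
    f≡ = +-cancelˡ-≡ j f _ (begin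
      j + f                ≡⟨ e ⟩
      l + i                ≡⟨ cong (_+ i) (m+[n∸m]≡n j≤l) ⟨
      j + (l ∸ j) + i      ≡⟨ +-assoc j (l ∸ j) i ⟩
      j + (l ∸ j + i)      ≡⟨ cong (_+_ j) (+-comm (l ∸ j) i) ⟩
      j + (i + (l ∸ j))    ∎)
  ... | no  j≰l = trans (shift-< j p l (≰⇒> j≰l)) (sym (reflect-> f p i (≰⇒> λ i≤f →
      <-irrefl (sym e) (+-mono-<-≤ (≰⇒> j≰l) i≤f))))

  -- The recursion is summed over all contractions. Its left sides make up the reflected Z; on the
  -- right the proper flats give Z by `properFlats-sum`, and the characteristic polynomials invert
  -- to a single power of t. The two monomials are the top flat's term t^(l+i) in degrees l and i.
  palindrome : ∀ l i → m + (l + i) ≤ N →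
    uniformZ q (m + (l + i)) l ℤ.+ monomial (+ 1) 0 i
      ≡ uniformZ q (m + (l + i)) i ℤ.+ monomial (+ 1) (l + i) i
  palindrome l i r≤N = begin
    uniformZ q r l ℤ.+ ε₀
      ≡⟨ cong (ℤ._+_ (uniformZ q r l)) (bsum-emptyʳ r {λ _ u → monomial ε₀ 0 u} (λ _ _ _ → refl)) ⟨
    uniformZ q r l ℤ.+ bsum r (λ _ u → monomial ε₀ 0 u)
      ≡⟨ bsum-+ r (λ j u → shift j (q u) l) (λ _ u → monomial ε₀ 0 u) ⟨
    bsum r (λ j u → shift j (q u) l ℤ.+ monomial ε₀ 0 u)
      ≡⟨ bsum-cong r step ⟩
    bsum r (λ _ u → properFlats q u i ℤ.+ uniformChar m u i)
      ≡⟨ bsum-+ r (λ _ u → properFlats q u i) (λ _ u → uniformChar m u i) ⟩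
    bsum r (λ _ u → properFlats q u i) ℤ.+ bsum r (λ _ u → uniformChar m u i)
      ≡⟨ cong₂ ℤ._+_ (properFlats-sum q r i) (bsum-invertʳ r (λ b → monomial (+ 1) (b ∸ m) i)) ⟩
    uniformZ q r i ℤ.+ monomial (+ 1) (r ∸ m) i
      ≡⟨ cong (λ t → uniformZ q r i ℤ.+ monomial (+ 1) t i) (m+n∸m≡n m (l + i)) ⟩
    uniformZ q r i ℤ.+ monomial (+ 1) (l + i) i ∎
    where
    r = m + (l + i)
    ε₀ = monomial (+ 1) 0 i
    step : ∀ j u → j + u ≡ r → shift j (q u) l ℤ.+ monomial ε₀ 0 u ≡ properFlats q u i ℤ.+ uniformChar m u i
    step j u e with u ≤? m
    ... | yes u≤m = cong₂ ℤ._+_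
      (trans (shift-zero j l λ x _ → small u x u≤m)
             (sym (bsum-zero u λ c v e′ → bsum-zero c λ a b _ →
               trans (cong (ℤ._*_ (sgn a)) (shift-zero b i λ x _ → small v x (≤-trans (subst (v ≤_) e′ (m≤n+m v c)) u≤m)))
                     (ℤₚ.*-zeroʳ (sgn a)))))
      (sym (uniformChar-≤ m u i u≤m))
    ... | no  u≰m = begin
      shift j (q u) l ℤ.+ monomial ε₀ 0 u
        ≡⟨ cong₂ ℤ._+_ (shift-reflect (q u) j (u ∸ m) l i e″) (monomial-off ε₀ 0 u λ u≡0 → u≰m (subst (_≤ m) (sym u≡0) z≤n)) ⟩
      reflect (u ∸ m) (q u) i ℤ.+ + 0
        ≡⟨ ℤₚ.+-identityʳ _ ⟩
      reflect (u ∸ m) (q u) i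
        ≡⟨ rec u i (≰⇒> u≰m) (≤-trans (subst (u ≤_) e (m≤n+m u j)) r≤N) ⟩
      properFlats q u i ℤ.+ uniformChar m u i ∎
      where
      e″ : j + (u ∸ m) ≡ l + i
      e″ = begin
        j + (u ∸ m)    ≡⟨ +-∸-assoc j (<⇒≤ (≰⇒> u≰m)) ⟨
        j + u ∸ m      ≡⟨ cong (_∸ m) e ⟩
        r ∸ m          ≡⟨ m+n∸m≡n m (l + i) ⟩
        l + i          ∎

  uniformZ-comm : ∀ l i → m + (suc l + suc i) ≤ N →
    uniformZ q (m + (suc l + suc i)) (suc l) ≡ uniformZ q (m + (suc l + suc i)) (suc i)
  uniformZ-comm l i r≤N = begin
    Z (suc l)                                                      ≡⟨ ℤₚ.+-identityʳ _ ⟨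
    Z (suc l) ℤ.+ + 0                                              ≡⟨ palindrome (suc l) (suc i) r≤N ⟩
    Z (suc i) ℤ.+ monomial (+ 1) (suc l + suc i) (suc i)           ≡⟨ cong (ℤ._+_ (Z (suc i))) (monomial-off (+ 1) (suc l + suc i) (suc i) λ e → m+1+n≢n l (trans (+-suc l (suc i)) (sym e))) ⟩
    Z (suc i) ℤ.+ + 0                                              ≡⟨ ℤₚ.+-identityʳ _ ⟩
    Z (suc i)                                                      ∎
    where Z = uniformZ q (m + (suc l + suc i))

  -- Reaching degree k after the shift by `j` needs the coefficient of `q u` at its full rank u - m,
  -- which the degree bound excludes.
  uniformZ-top : ∀ k → m + k ≤ N → uniformZ q (m + k) k ≡ + 0
  uniformZ-top k r≤N = bsum-zero (m + k) λ j u e → shift-zero j k λ x e′ → zero′ j u x e e′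
    where
    zero′ : ∀ j u x → j + u ≡ m + k → j + x ≡ k → q u x ≡ + 0
    zero′ j u x e e′ with u ≤? m
    ... | yes u≤m = small u x u≤m
    ... | no  u≰m = deg u x (≰⇒> u≰m) (≤-trans (subst (u ≤_) e (m≤n+m u j)) r≤N) (subst (_≤ 2 * x) (sym x≡) (m≤m+n x _))
      where
      x≡ : u ∸ m ≡ x
      x≡ = trans (cong (_∸ m) (+-cancelˡ-≡ j u (m + x) (trans e (trans (cong (_+_ m) (sym e′)) (lem m j x))))) (m+n∸m≡n m x)
        where
        lem : ∀ m j x → m + (j + x) ≡ j + (m + x)
        lem = ℕ-Solver.solve-∀

  uniformZ-0 : ∀ k → m + suc k ≤ N → uniformZ q (m + suc k) 0 ≡ + 1
  uniformZ-0 k r≤N = begin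
    uniformZ q (m + suc k) 0               ≡⟨ ℤₚ.+-identityʳ _ ⟨
    uniformZ q (m + suc k) 0 ℤ.+ + 0       ≡⟨ palindrome 0 (suc k) r≤N ⟩
    uniformZ q (m + suc k) (suc k) ℤ.+ monomial (+ 1) (suc k) (suc k)
                                           ≡⟨ cong₂ ℤ._+_ (uniformZ-top (suc k) r≤N) (monomial-diag (+ 1) (suc k)) ⟩
    + 1                                    ∎

  -- Solving the recurrence for the coefficients of Z

  -- The claim for d = k + i with its denominators cleared; `k = suc κ` encodes i < d.
  Formula : ℕ → ℕ → Set
  Formula κ i = let k = suc κ in
    + m ℤ.* + ((k + i + 2 * m) C m) ℤ.* uniformZ q (m + (k + i)) i
      ≡ + (((k + i + 2 * m) C (i + m)) * ((k + i) C i)) ℤ.* altSum m k i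

  -- The form C(m+k+i, i) G(i) / k with G a polynomial of degree less than k; only here is it
  -- visible that the claimed values satisfy the recurrence.
  PolyFormula : ℕ → ℕ → Set
  PolyFormula κ i = let k = suc κ in
    + k ℤ.* uniformZ q (m + (k + i)) i ≡ + ((m + (k + i)) C i) ℤ.* polySum m κ i

  module _ {{m≢0 : NonZero m}} where

    C₁≢0 : ∀ κ i → NonZero ((suc κ + i + 2 * m) C m)
    C₁≢0 κ i = subst (λ n → NonZero (n C m)) (lem (suc κ) i m) (C-nonZero m (m + (suc κ + i)))
      where
      lem : ∀ k i m → m + (m + (k + i)) ≡ k + i + 2 * m
      lem = ℕ-Solver.solve-∀

    mC₁≢0 : ∀ κ i → ℤ.NonZero (+ m ℤ.* + ((suc κ + i + 2 * m) C m))
    mC₁≢0 κ i = ℤₚ.i*j≢0 (+ m) (+ ((suc κ + i + 2 * m) C m)) {{m≢0}} {{C₁≢0 κ i}}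

    scaled : ∀ κ i → let k = suc κ in
      + m ℤ.* + ((k + i + 2 * m) C m) ℤ.* (+ ((m + (k + i)) C i) ℤ.* polySum m κ i)
        ≡ + k ℤ.* (+ (((k + i + 2 * m) C (i + m)) * ((k + i) C i)) ℤ.* altSum m k i)
    scaled κ i = begin
      + m ℤ.* + C₁ ℤ.* (+ C₂ ℤ.* G)      ≡⟨ assoc (+ m) (+ C₁) (+ C₂) G ⟩
      + m ℤ.* + C₁ ℤ.* + C₂ ℤ.* G        ≡⟨ cong (ℤ._* G) (trans (ℤₚ.pos-* (m * C₁) C₂) (cong (ℤ._* + C₂) (ℤₚ.pos-* m C₁))) ⟨
      + (m * C₁ * C₂) ℤ.* G              ≡⟨ polySum-altSum m κ i ⟩
      + (k * D₁ * D₂) ℤ.* A              ≡⟨ cong (λ t → + t ℤ.* A) (*-assoc k D₁ D₂) ⟩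
      + (k * (D₁ * D₂)) ℤ.* A            ≡⟨ cong (ℤ._* A) (ℤₚ.pos-* k (D₁ * D₂)) ⟩
      + k ℤ.* + (D₁ * D₂) ℤ.* A          ≡⟨ ℤₚ.*-assoc (+ k) (+ (D₁ * D₂)) A ⟩
      + k ℤ.* (+ (D₁ * D₂) ℤ.* A)        ∎
      where
      k = suc κ
      C₁ = (k + i + 2 * m) C m
      C₂ = (m + (k + i)) C i
      D₁ = (k + i + 2 * m) C (i + m)
      D₂ = (k + i) C i
      G = polySum m κ i
      A = altSum m k i
      assoc : ∀ a b c d → a ℤ.* b ℤ.* (c ℤ.* d) ≡ a ℤ.* b ℤ.* c ℤ.* d
      assoc = solve-∀

    swap : ∀ a b c → a ℤ.* (b ℤ.* c) ≡ b ℤ.* (a ℤ.* c)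
    swap = solve-∀

    toPoly : ∀ κ i → Formula κ i → PolyFormula κ i
    toPoly κ i w = ℤₚ.*-cancelˡ-≡ mC₁ _ _ {{mC₁≢0 κ i}} (begin
      mC₁ ℤ.* (+ suc κ ℤ.* Z)      ≡⟨ swap mC₁ (+ suc κ) Z ⟩
      + suc κ ℤ.* (mC₁ ℤ.* Z)      ≡⟨ cong (ℤ._*_ (+ suc κ)) w ⟩
      _                            ≡⟨ scaled κ i ⟨
      mC₁ ℤ.* (+ ((m + (suc κ + i)) C i) ℤ.* polySum m κ i) ∎)
      where
      mC₁ = + m ℤ.* + ((suc κ + i + 2 * m) C m)
      Z = uniformZ q (m + (suc κ + i)) i

    fromPoly : ∀ κ i → PolyFormula κ i → Formula κ i
    fromPoly κ i w = ℤₚ.*-cancelˡ-≡ (+ suc κ) _ _ (begin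
      + suc κ ℤ.* (mC₁ ℤ.* Z)      ≡⟨ swap (+ suc κ) mC₁ Z ⟩
      mC₁ ℤ.* (+ suc κ ℤ.* Z)      ≡⟨ cong (ℤ._*_ mC₁) w ⟩
      mC₁ ℤ.* (+ ((m + (suc κ + i)) C i) ℤ.* polySum m κ i) ≡⟨ scaled κ i ⟩
      _                            ∎)
      where
      mC₁ = + m ℤ.* + ((suc κ + i + 2 * m) C m)
      Z = uniformZ q (m + (suc κ + i)) i

    formula-0 : ∀ κ → m + (suc κ + 0) ≤ N → Formula κ 0
    formula-0 κ r≤N = begin
      + m ℤ.* + C₁ ℤ.* uniformZ q (m + (suc κ + 0)) 0
        ≡⟨ cong (ℤ._*_ (+ m ℤ.* + C₁)) (uniformZ-0 (κ + 0) r≤N) ⟩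
      + m ℤ.* + C₁ ℤ.* + 1
        ≡⟨ ℤₚ.*-identityʳ _ ⟩
      + m ℤ.* + C₁
        ≡⟨ ℤₚ.*-comm (+ m) (+ C₁) ⟩
      + C₁ ℤ.* + m
        ≡⟨ cong₂ (λ x y → + x ℤ.* y) (*-identityʳ C₁) (altSum-0ʳ m κ) ⟨
      + (C₁ * 1) ℤ.* altSum m (suc κ) 0 ∎
      where C₁ = (suc κ + 0 + 2 * m) C m

    -- The alternating sums of k Z and of the claimed values `F` over all contractions are both 0:
    -- the first by inversion and the degree bound, the second as a finite difference. Their
    -- summands with j > 0 agree by induction, hence so do those with j = 0.
    formula-≥ : ∀ κ i → κ < i → m + (suc κ + i) ≤ N → (∀ l → l < i → Formula κ l) → Formula κ i
    formula-≥ κ i κ<i r≤N ih = fromPoly κ i (begin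
      + k ℤ.* Z r i                                     ≡⟨ ℤₚ.*-identityˡ _ ⟨
      -- The factor `+ 1` is `sgn 0`: it gives both sides the shape of the summand j = 0.
      + 1 ℤ.* (+ k ℤ.* Z r i)                           ≡⟨ ℤₚ.i-j≡0⇒i≡j _ _ difference ⟩
      + 1 ℤ.* F r                                       ≡⟨ ℤₚ.*-identityˡ _ ⟩
      F r                                               ≡⟨ F-value i ⟩
      + (r C i) ℤ.* polySum m κ i                       ∎)
      where
      k = suc κ
      r = m + (k + i)
      x = m + k
      Z = uniformZ q
      -- This is C(s, x) times `polySum` at s - x, and 0 for s < x, so it is meaningful for every
      -- size `s` in the alternating sum.
      F : ℕ → ℤ
      F s = bsum s (λ a b → monomial (+ 1) x b ℤ.* polySum m κ a)
      i+x : ∀ i → i + x ≡ m + (k + i)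
      i+x i = lem i m k
        where
        lem : ∀ i m k → i + (m + k) ≡ m + (k + i)
        lem = ℕ-Solver.solve-∀
      F-value : ∀ i → F (m + (k + i)) ≡ + ((m + (k + i)) C i) ℤ.* polySum m κ i
      F-value i = subst (λ n → F n ≡ + (n C i) ℤ.* polySum m κ i) (i+x i) (bsum-select i x (polySum m κ))
      total-Z : bsum r (λ j s → sgn j ℤ.* (+ k ℤ.* shift j (Z s) i)) ≡ + 0
      total-Z = begin
        bsum r (λ j s → sgn j ℤ.* (+ k ℤ.* shift j (Z s) i))
          ≡⟨ bsum-cong r (λ j s _ → swap (sgn j) (+ k) _) ⟩
        bsum r (λ j s → + k ℤ.* (sgn j ℤ.* shift j (Z s) i))
          ≡⟨ bsum-* r (+ k) _ ⟩
        + k ℤ.* bsum r (λ j s → sgn j ℤ.* shift j (Z s) i)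
          ≡⟨ cong (ℤ._*_ (+ k)) (trans (uniformZ-invert q r i) (deg r i (m<m+n m z<s) r≤N bound)) ⟩
        + k ℤ.* + 0
          ≡⟨ ℤₚ.*-zeroʳ (+ k) ⟩
        + 0 ∎
        where
        bound : r ∸ m ≤ 2 * i
        bound = subst₂ _≤_ (sym (m+n∸m≡n m (k + i))) (cong (_+_ i) (sym (+-identityʳ i))) (+-monoˡ-≤ i κ<i)
      total-F : bsum r (λ j s → sgn j ℤ.* F s) ≡ + 0
      total-F = begin
        bsum r (λ j s → sgn j ℤ.* F s)
          ≡⟨ cong (λ n → bsum n (λ j s → sgn j ℤ.* F s)) (sym (i+x i)) ⟩
        bsum (i + x) (λ j s → sgn j ℤ.* F s)
          ≡⟨ bsum-select-alternating i x (polySum m κ) ⟩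
        + ((i + x) C i) ℤ.* bsum i (λ j a → sgn j ℤ.* polySum m κ a)
          ≡⟨ cong (ℤ._*_ (+ ((i + x) C i))) (bsum-polySum i m κ κ<i) ⟩
        + ((i + x) C i) ℤ.* + 0
          ≡⟨ ℤₚ.*-zeroʳ (+ ((i + x) C i)) ⟩
        + 0 ∎
      agree : ∀ j s → suc j + s ≡ r → + k ℤ.* shift (suc j) (Z s) i ≡ F s
      agree j s e with suc j ≤? i
      -- Dropping j + 1 elements lowers rank and degree by j + 1 alike, so `k` is unchanged and the
      -- induction hypothesis applies at degree `l`.
      ... | yes j<i = begin
        + k ℤ.* shift (suc j) (Z s) i     ≡⟨ cong (ℤ._*_ (+ k)) (shift-≥ (suc j) (Z s) i j<i) ⟩
        + k ℤ.* Z s l                     ≡⟨ cong (λ t → + k ℤ.* Z t l) s≡ ⟩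
        + k ℤ.* Z (m + (k + l)) l         ≡⟨ toPoly κ l (ih l l<i) ⟩
        + ((m + (k + l)) C l) ℤ.* polySum m κ l ≡⟨ F-value l ⟨
        F (m + (k + l))                   ≡⟨ cong F s≡ ⟨
        F s                               ∎
        where
        l = i ∸ suc j
        l<i : l < i
        l<i = ∸-monoʳ-< z<s j<i
        s≡ : s ≡ m + (k + l)
        s≡ = +-cancelˡ-≡ (suc j) s _ (begin
          suc j + s                        ≡⟨ e ⟩
          m + (k + i)                      ≡⟨ cong (λ t → m + (k + t)) (m+[n∸m]≡n j<i) ⟨
          m + (k + (suc j + l))            ≡⟨ lem m k (suc j) l ⟩
          suc j + (m + (k + l))            ∎)
          where
          lem : ∀ m k j l → m + (k + (j + l)) ≡ j + (m + (k + l))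
          lem = ℕ-Solver.solve-∀
      ... | no  j≮i = begin
        + k ℤ.* shift (suc j) (Z s) i     ≡⟨ cong (ℤ._*_ (+ k)) (shift-< (suc j) (Z s) i (≰⇒> j≮i)) ⟩
        + k ℤ.* + 0                       ≡⟨ ℤₚ.*-zeroʳ (+ k) ⟩
        + 0                               ≡⟨ bsum-select-< s x (polySum m κ) s<x ⟨
        F s                               ∎
        where
        s<x : s < x
        s<x = ≰⇒> λ x≤s → <-irrefl (trans (i+x i) (sym e)) (+-mono-<-≤ (≰⇒> j≮i) x≤s)
      difference : + 1 ℤ.* (+ k ℤ.* Z r i) ℤ.- + 1 ℤ.* F r ≡ + 0
      difference = begin
        + 1 ℤ.* (+ k ℤ.* Z r i) ℤ.- + 1 ℤ.* F r
          ≡⟨ lem (+ 1) (+ k ℤ.* Z r i) (F r) ⟩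
        f 0 r
          ≡⟨ bsum-emptyˡ r {f} (λ j s e → cancel (sgn (suc j)) (agree j s e)) ⟨
        bsum r f
          ≡⟨ bsum-+ r (λ j s → sgn j ℤ.* (+ k ℤ.* shift j (Z s) i)) (λ j s → (- (+ 1)) ℤ.* (sgn j ℤ.* F s)) ⟩
        bsum r (λ j s → sgn j ℤ.* (+ k ℤ.* shift j (Z s) i)) ℤ.+ bsum r (λ j s → (- (+ 1)) ℤ.* (sgn j ℤ.* F s))
          ≡⟨ cong₂ ℤ._+_ total-Z (trans (bsum-* r (- (+ 1)) (λ j s → sgn j ℤ.* F s)) (cong (ℤ._*_ (- (+ 1))) total-F)) ⟩
        + 0 ∎
        where
        f : ℕ → ℕ → ℤ
        f j s = sgn j ℤ.* (+ k ℤ.* shift j (Z s) i) ℤ.+ (- (+ 1)) ℤ.* (sgn j ℤ.* F s)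
        lem : ∀ s a b → s ℤ.* a ℤ.- s ℤ.* b ≡ s ℤ.* a ℤ.+ (- (+ 1)) ℤ.* (s ℤ.* b)
        lem = solve-∀
        lem₀ : ∀ s a → s ℤ.* a ℤ.+ (- (+ 1)) ℤ.* (s ℤ.* a) ≡ + 0
        lem₀ = solve-∀
        cancel : ∀ s {a b} → a ≡ b → s ℤ.* a ℤ.+ (- (+ 1)) ℤ.* (s ℤ.* b) ≡ + 0
        cancel s {a} refl = lem₀ s a

    formula-sym : ∀ κ i → m + (suc κ + suc i) ≤ N → Formula i (suc κ) → Formula κ (suc i)
    formula-sym κ i r≤N w = begin
      + m ℤ.* + ((suc κ + suc i + 2 * m) C m) ℤ.* uniformZ q (m + (suc κ + suc i)) (suc i)
        ≡⟨ cong (ℤ._*_ (+ m ℤ.* + ((suc κ + suc i + 2 * m) C m))) (uniformZ-comm κ i r≤N) ⟨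
      + m ℤ.* + ((suc κ + suc i + 2 * m) C m) ℤ.* uniformZ q (m + (suc κ + suc i)) (suc κ)
        ≡⟨ cong (λ n → + m ℤ.* + ((n + 2 * m) C m) ℤ.* uniformZ q (m + n) (suc κ)) (+-comm (suc κ) (suc i)) ⟩
      + m ℤ.* + ((suc i + suc κ + 2 * m) C m) ℤ.* uniformZ q (m + (suc i + suc κ)) (suc κ)
        ≡⟨ w ⟩
      + (((suc i + suc κ + 2 * m) C (suc κ + m)) * ((suc i + suc κ) C suc κ)) ℤ.* altSum m (suc i) (suc κ)
        ≡⟨ cong₂ (λ x y → + x ℤ.* y)
             (cong₂ _*_
               (trans (C-complement (suc κ + m) (suc i + m) (e₁ (suc κ) (suc i) m)) (cong (λ n → (n + 2 * m) C (suc i + m)) (+-comm (suc i) (suc κ))))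
               (trans (C-complement (suc κ) (suc i) (+-comm (suc κ) (suc i))) (cong (_C suc i) (+-comm (suc i) (suc κ)))))
             (altSum-comm m i κ) ⟩
      + (((suc κ + suc i + 2 * m) C (suc i + m)) * ((suc κ + suc i) C suc i)) ℤ.* altSum m (suc κ) (suc i) ∎
      where
      e₁ : ∀ k i m → (k + m) + (i + m) ≡ i + k + 2 * m
      e₁ = ℕ-Solver.solve-∀

    -- Induction on κ + i rather than on i: for k > i > 0 the value is read at the transposed
    -- position, whose recurrence consults other entries with the roles exchanged, smaller only in
    -- this sum.
    formula : ∀ κ i → m + (suc κ + i) ≤ N → Formula κ i
    formula κ i = <-rec Goal step (κ + i) κ i refl
      where
      Goal : ℕ → Set
      Goal n = ∀ κ i → κ + i ≡ n → m + (suc κ + i) ≤ N → Formula κ i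
      step : ∀ n → (∀ {n′} → n′ < n → Goal n′) → Goal n
      step _ ih κ zero    refl r≤N = formula-0 κ r≤N
      step _ ih κ (suc i) refl r≤N with κ ≤? i
      ... | yes κ≤i = formula-≥ κ (suc i) (s≤s κ≤i) r≤N λ l l<1+i →
              ih (+-monoʳ-< κ l<1+i) κ l refl (≤-trans (+-monoʳ-≤ m (+-monoʳ-≤ (suc κ) (<⇒≤ l<1+i))) r≤N)
      ... | no  κ≰i = formula-sym κ i r≤N (formula-≥ i (suc κ) (m<n⇒m<1+n (≰⇒> κ≰i)) (subst (λ n → m + n ≤ N) (+-comm (suc κ) (suc i)) r≤N) λ l l<1+κ →
              ih (subst (i + l <_) (trans (+-comm i (suc κ)) (sym (+-suc κ i))) (+-monoʳ-< i l<1+κ)) i l refl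
                 (≤-trans (+-monoʳ-≤ m (subst (suc i + l ≤_) (+-comm (suc i) (suc κ)) (+-monoʳ-≤ (suc i) (<⇒≤ l<1+κ)))) r≤N))

-- Cardinalities of subsets

subsetᵇ⇒⊆ : ∀ {n} (p q : Subset n) → subsetᵇ p q ≡ true → p ⊆ q
subsetᵇ⇒⊆ (true  ∷ p) (true ∷ q) e here      = here
subsetᵇ⇒⊆ (true  ∷ p) (true ∷ q) e (there x) = there (subsetᵇ⇒⊆ p q e x)
subsetᵇ⇒⊆ (false ∷ p) (_    ∷ q) e (there x) = there (subsetᵇ⇒⊆ p q e x)

⊆⇒subsetᵇ : ∀ {n} (p q : Subset n) → p ⊆ q → subsetᵇ p q ≡ true
⊆⇒subsetᵇ []          []          _   = refl
⊆⇒subsetᵇ (true  ∷ p) (true  ∷ q) p⊆q = ⊆⇒subsetᵇ p q (drop-∷-⊆ p⊆q)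
⊆⇒subsetᵇ (true  ∷ p) (false ∷ q) p⊆q with () ← p⊆q here
⊆⇒subsetᵇ (false ∷ p) (_     ∷ q) p⊆q = ⊆⇒subsetᵇ p q (drop-∷-⊆ p⊆q)

∣p∪q∣+∣p∩q∣ : ∀ {n} (p q : Subset n) → ∣ p ∪ q ∣ + ∣ p ∩ q ∣ ≡ ∣ p ∣ + ∣ q ∣
∣p∪q∣+∣p∩q∣ []          []          = refl
∣p∪q∣+∣p∩q∣ (true  ∷ p) (true  ∷ q) = cong suc (trans (+-suc _ _) (trans (cong suc (∣p∪q∣+∣p∩q∣ p q)) (sym (+-suc _ _))))
∣p∪q∣+∣p∩q∣ (true  ∷ p) (false ∷ q) = cong suc (∣p∪q∣+∣p∩q∣ p q)
∣p∪q∣+∣p∩q∣ (false ∷ p) (true  ∷ q) = trans (cong suc (∣p∪q∣+∣p∩q∣ p q)) (sym (+-suc _ _))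
∣p∪q∣+∣p∩q∣ (false ∷ p) (false ∷ q) = ∣p∪q∣+∣p∩q∣ p q

∣q∣+∣p─q∣ : ∀ {n} (p q : Subset n) → q ⊆ p → ∣ q ∣ + ∣ p ─ q ∣ ≡ ∣ p ∣
∣q∣+∣p─q∣ []          []          _   = refl
∣q∣+∣p─q∣ (true  ∷ p) (true  ∷ q) q⊆p = cong suc (∣q∣+∣p─q∣ p q (drop-∷-⊆ q⊆p))
∣q∣+∣p─q∣ (true  ∷ p) (false ∷ q) q⊆p = trans (+-suc _ _) (cong suc (∣q∣+∣p─q∣ p q (drop-∷-⊆ q⊆p)))
∣q∣+∣p─q∣ (false ∷ p) (true  ∷ q) q⊆p with () ← q⊆p here
∣q∣+∣p─q∣ (false ∷ p) (false ∷ q) q⊆p = ∣q∣+∣p─q∣ p q (drop-∷-⊆ q⊆p)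

∣p─q∣≡0⇒q≡p : ∀ {n} (p q : Subset n) → q ⊆ p → ∣ p ─ q ∣ ≡ 0 → q ≡ p
∣p─q∣≡0⇒q≡p []          []          _   _ = refl
∣p─q∣≡0⇒q≡p (true  ∷ p) (true  ∷ q) q⊆p e = cong (true ∷_) (∣p─q∣≡0⇒q≡p p q (drop-∷-⊆ q⊆p) e)
∣p─q∣≡0⇒q≡p (false ∷ p) (true  ∷ q) q⊆p e with () ← q⊆p here
∣p─q∣≡0⇒q≡p (false ∷ p) (false ∷ q) q⊆p e = cong (false ∷_) (∣p─q∣≡0⇒q≡p p q (drop-∷-⊆ q⊆p) e)

∣p─p∣≡0 : ∀ {n} (p : Subset n) → ∣ p ─ p ∣ ≡ 0
∣p─p∣≡0 p = +-cancelˡ-≡ ∣ p ∣ _ _ (trans (∣q∣+∣p─q∣ p p ⊆-refl) (sym (+-identityʳ ∣ p ∣)))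

∣p─q∣>0⇒∃ : ∀ {n} (p q : Subset n) → 0 < ∣ p ─ q ∣ → ∃ λ x → lookup p x ≡ true × lookup q x ≡ false
∣p─q∣>0⇒∃ [] [] ()
∣p─q∣>0⇒∃ (true ∷ p) (false ∷ q) _ = zero , refl , refl
∣p─q∣>0⇒∃ (true ∷ p) (true ∷ q) lt with x , e , e′ ← ∣p─q∣>0⇒∃ p q lt = suc x , e , e′
∣p─q∣>0⇒∃ (false ∷ p) (true ∷ q) lt with x , e , e′ ← ∣p─q∣>0⇒∃ p q lt = suc x , e , e′
∣p─q∣>0⇒∃ (false ∷ p) (false ∷ q) lt with x , e , e′ ← ∣p─q∣>0⇒∃ p q lt = suc x , e , e′

p⊆q─r⇒∣p∪r∣ : ∀ {n} (p q r : Subset n) → p ⊆ q ─ r → ∣ p ∪ r ∣ ≡ ∣ p ∣ + ∣ r ∣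
p⊆q─r⇒∣p∪r∣ []          []      []          _ = refl
p⊆q─r⇒∣p∪r∣ (true  ∷ p) (_ ∷ q) (true  ∷ r) s with () ← s here
p⊆q─r⇒∣p∪r∣ (true  ∷ p) (_ ∷ q) (false ∷ r) s = cong suc (p⊆q─r⇒∣p∪r∣ p q r (drop-∷-⊆ s))
p⊆q─r⇒∣p∪r∣ (false ∷ p) (_ ∷ q) (true  ∷ r) s = trans (cong suc (p⊆q─r⇒∣p∪r∣ p q r (drop-∷-⊆ s))) (sym (+-suc _ _))
p⊆q─r⇒∣p∪r∣ (false ∷ p) (_ ∷ q) (false ∷ r) s = p⊆q─r⇒∣p∪r∣ p q r (drop-∷-⊆ s)

∪-least : ∀ {n} {p q r : Subset n} → p ⊆ r → q ⊆ r → p ∪ q ⊆ r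
∪-least {p = p} {q} p⊆r q⊆r x∈ with x∈p∪q⁻ p q x∈
... | inj₁ x∈p = p⊆r x∈p
... | inj₂ x∈q = q⊆r x∈q

⁅x⁆⊆ : ∀ {n} {p : Subset n} {x} → x ∈ p → ⁅ x ⁆ ⊆ p
⁅x⁆⊆ {p = p} {x} x∈p y∈ = subst (_∈ p) (sym (x∈⁅y⁆⇒x≡y x y∈)) x∈p

∣p∪⁅x⁆∣ : ∀ {n} (p : Subset n) x → lookup p x ≡ false → ∣ p ∪ ⁅ x ⁆ ∣ ≡ suc ∣ p ∣
∣p∪⁅x⁆∣ (false ∷ p) zero    _ = cong (suc ∘ ∣_∣) (∪-identityʳ p)
∣p∪⁅x⁆∣ (true  ∷ p) (suc x) e = cong suc (∣p∪⁅x⁆∣ p x e)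
∣p∪⁅x⁆∣ (false ∷ p) (suc x) e = ∣p∪⁅x⁆∣ p x e

initial : ∀ n → ℕ → Subset n
initial zero    _       = []
initial (suc n) zero    = false ∷ initial n zero
initial (suc n) (suc k) = true ∷ initial n k

∣initial∣ : ∀ n k → k ≤ n → ∣ initial n k ∣ ≡ k
∣initial∣ zero    zero    _         = refl
∣initial∣ (suc n) zero    _         = ∣initial∣ n zero z≤n
∣initial∣ (suc n) (suc k) (s≤s k≤n) = cong suc (∣initial∣ n k k≤n)

-- Sums over subsets

subsetSum : ∀ n → (Subset n → ℤ) → ℤ
subsetSum zero    f = f []
subsetSum (suc n) f = subsetSum n (λ p → f (true ∷ p)) ℤ.+ subsetSum n (λ p → f (false ∷ p))

subsetSum-zero : ∀ n {f} → (∀ p → f p ≡ + 0) → subsetSum n f ≡ + 0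
subsetSum-zero zero    e = e []
subsetSum-zero (suc n) e = cong₂ ℤ._+_ (subsetSum-zero n λ p → e (true ∷ p)) (subsetSum-zero n λ p → e (false ∷ p))

sumℤ-allSubsets : ∀ n f → sumℤ (map f (allSubsets n)) ≡ subsetSum n f
sumℤ-allSubsets zero    f = ℤₚ.+-identityʳ (f [])
sumℤ-allSubsets (suc n) f = begin
  sumℤ (map f (map (true ∷_) xs ++ map (false ∷_) xs))
    ≡⟨ cong sumℤ (map-++ f (map (true ∷_) xs) (map (false ∷_) xs)) ⟩
  sumℤ (map f (map (true ∷_) xs) ++ map f (map (false ∷_) xs))
    ≡⟨ sumℤ-++ (map f (map (true ∷_) xs)) _ ⟩
  sumℤ (map f (map (true ∷_) xs)) ℤ.+ sumℤ (map f (map (false ∷_) xs))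
    ≡⟨ cong₂ (λ u v → sumℤ u ℤ.+ sumℤ v) (map-∘ xs) (map-∘ xs) ⟨
  sumℤ (map (λ p → f (true ∷ p)) xs) ℤ.+ sumℤ (map (λ p → f (false ∷ p)) xs)
    ≡⟨ cong₂ ℤ._+_ (sumℤ-allSubsets n _) (sumℤ-allSubsets n _) ⟩
  subsetSum (suc n) f ∎
  where xs = allSubsets n

-- Each element of `E` enters `F` or `E ─ F`, which is exactly the recursion of `bsum`, so subsets
-- need not be counted by size.
subsetSum-bsum : ∀ {n} (E : Subset n) {f g} →
  (∀ F → subsetᵇ F E ≡ true → f F ≡ g ∣ F ∣ ∣ E ─ F ∣) → (∀ F → subsetᵇ F E ≡ false → f F ≡ + 0) →
  subsetSum n f ≡ bsum ∣ E ∣ g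
subsetSum-bsum []          h h₀ = h [] refl
subsetSum-bsum (true  ∷ E) h h₀ = cong₂ ℤ._+_
  (subsetSum-bsum E (λ F → h (true ∷ F)) (λ F → h₀ (true ∷ F)))
  (subsetSum-bsum E (λ F → h (false ∷ F)) (λ F → h₀ (false ∷ F)))
subsetSum-bsum (false ∷ E) h h₀ = trans (cong₂ ℤ._+_
  (subsetSum-zero _ λ F → h₀ (true ∷ F) refl)
  (subsetSum-bsum E (λ F → h (false ∷ F)) (λ F → h₀ (false ∷ F))))
  (ℤₚ.+-identityˡ _)

sumP-map : ∀ {A : Set} (f : A → Poly) xs i → sumP (map f xs) i ≡ sumℤ (map (λ x → f x i) xs)
sumP-map f []       i = refl
sumP-map f (x ∷ xs) i = cong (ℤ._+_ (f x i)) (sumP-map f xs i)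

sumℤ-filter : ∀ {A : Set} (b : A → Bool) (f : A → ℤ) xs →
  sumℤ (map f (filter (λ x → b x Bool.≟ true) xs)) ≡ sumℤ (map (λ x → if b x then f x else + 0) xs)
sumℤ-filter b f []       = refl
sumℤ-filter b f (x ∷ xs) with b x
... | true  = cong (ℤ._+_ (f x)) (sumℤ-filter b f xs)
... | false = trans (sumℤ-filter b f xs) (sym (ℤₚ.+-identityˡ _))

allᵇ-true : ∀ {A : Set} (f : A → Bool) xs → (∀ x → f x ≡ true) → allᵇ f xs ≡ true
allᵇ-true f []       e = refl
allᵇ-true f (x ∷ xs) e = cong₂ _∧_ (e x) (allᵇ-true f xs e)

allᵇ-false : ∀ {A : Set} (f : A → Bool) {xs x} → x ∈ˡ xs → f x ≡ false → allᵇ f xs ≡ false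
allᵇ-false f {_ ∷ xs} (here refl) e = cong (_∧ allᵇ f xs) e
allᵇ-false f {y ∷ xs} (there x∈)  e = trans (cong (f y ∧_) (allᵇ-false f x∈ e)) (∧-zeroʳ (f y))

<ᵇ-true : ∀ {a b} → a < b → (a <ᵇ b) ≡ true
<ᵇ-true {zero}  {suc b} _         = refl
<ᵇ-true {suc a} {suc b} (s≤s a<b) = <ᵇ-true a<b

<ᵇ-false : ∀ {a b} → b ≤ a → (a <ᵇ b) ≡ false
<ᵇ-false {a}     {zero}  _         = refl
<ᵇ-false {suc a} {suc b} (s≤s b≤a) = <ᵇ-false b≤a

-- Flats, contractions and characteristic polynomials of uniform matroids

-- If `a` or `b` reaches the cap `e`, that term bounds the one of `y` and the other bounds the one
-- of `x`; otherwise the right side is a + b and `eq` suffices.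
⊓-submodular : ∀ e {a b x y} → x ≤ a → x ≤ b → y + x ≡ a + b → y ⊓ e + x ⊓ e ≤ a ⊓ e + b ⊓ e
⊓-submodular e {a} {b} {x} {y} x≤a x≤b eq with ≤-total e a | ≤-total e b
... | inj₁ e≤a | _ = +-mono-≤ (≤-trans (m⊓n≤n y e) (≤-reflexive (sym (m≥n⇒m⊓n≡n e≤a)))) (⊓-monoˡ-≤ e x≤b)
... | inj₂ _ | inj₁ e≤b = subst (_≤ a ⊓ e + b ⊓ e) (+-comm (x ⊓ e) (y ⊓ e))
      (+-mono-≤ (⊓-monoˡ-≤ e x≤a) (≤-trans (m⊓n≤n y e) (≤-reflexive (sym (m≥n⇒m⊓n≡n e≤b)))))
... | inj₂ a≤e | inj₂ b≤e = ≤-trans (+-mono-≤ (m⊓n≤m y e) (m⊓n≤m x e))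
      (≤-reflexive (trans eq (sym (cong₂ _+_ (m≤n⇒m⊓n≡m a≤e) (m≤n⇒m⊓n≡m b≤e)))))

⊓-contract : ∀ a f e → (a + f) ⊓ e ∸ f ⊓ e ≡ a ⊓ (e ∸ f)
⊓-contract a zero    e       = cong₂ (λ x y → x ⊓ e ∸ y) (+-identityʳ a) (⊓-zeroˡ e)
⊓-contract a (suc f) zero    = trans (cong (_∸ 0) (⊓-zeroʳ (a + suc f))) (sym (⊓-zeroʳ a))
⊓-contract a (suc f) (suc e) = trans (cong (λ t → t ⊓ suc e ∸ suc (f ⊓ e)) (+-suc a f)) (⊓-contract a f e)

-- The uniform matroids of corank m; for s ≤ m the rank s ∸ m is 0 and every element is a loop.
record IsUniform (m : ℕ) {n} (M : RawMatroid n) (s : ℕ) : Set where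
  field
    card    : ∣ ground M ∣ ≡ s
    uniform : ∀ A → A ⊆ ground M → rk M A ≡ ∣ A ∣ ⊓ (s ∸ m)

module Uniform {m n : ℕ} {M : RawMatroid n} {s : ℕ} (uni : IsUniform m M s) where
  open IsUniform uni

  E = ground M

  rank≡ : rank M ≡ s ∸ m
  rank≡ = begin
    rk M E             ≡⟨ uniform E ⊆-refl ⟩
    ∣ E ∣ ⊓ (s ∸ m)    ≡⟨ cong (_⊓ (s ∸ m)) card ⟩
    s ⊓ (s ∸ m)        ≡⟨ m≥n⇒m⊓n≡n (m∸n≤m s m) ⟩
    s ∸ m              ∎

  isMatroid : IsMatroid M
  isMatroid = record
    { rk-bound  = λ A A⊆E → subst (_≤ ∣ A ∣) (sym (uniform A A⊆E)) (m⊓n≤m ∣ A ∣ (s ∸ m))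
    ; rk-mono   = λ A B A⊆B B⊆E → subst₂ _≤_ (sym (uniform A (⊆-trans A⊆B B⊆E))) (sym (uniform B B⊆E))
                    (⊓-monoˡ-≤ (s ∸ m) (p⊆q⇒∣p∣≤∣q∣ A⊆B))
    ; rk-submod = λ A B A⊆E B⊆E → subst₂ _≤_
                    (sym (cong₂ _+_ (uniform (A ∪ B) (∪-least A⊆E B⊆E)) (uniform (A ∩ B) (⊆-trans (p∩q⊆p A B) A⊆E))))
                    (sym (cong₂ _+_ (uniform A A⊆E) (uniform B B⊆E)))
                    (⊓-submodular (s ∸ m) (∣p∩q∣≤∣p∣ A B) (∣p∩q∣≤∣q∣ A B) (∣p∪q∣+∣p∩q∣ A B))
    }

  loopless : m < s → Loopless M
  loopless m<s e e∈E = begin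
    rk M ⁅ e ⁆               ≡⟨ uniform ⁅ e ⁆ (⁅x⁆⊆ e∈E) ⟩
    ∣ ⁅ e ⁆ ∣ ⊓ (s ∸ m)      ≡⟨ cong (_⊓ (s ∸ m)) (∣⁅x⁆∣≡1 e) ⟩
    1 ⊓ (s ∸ m)              ≡⟨ m≤n⇒m⊓n≡m (m<n⇒0<n∸m m<s) ⟩
    1                        ∎

  ∣F∣+∣E─F∣ : ∀ {F} → F ⊆ E → ∣ F ∣ + ∣ E ─ F ∣ ≡ s
  ∣F∣+∣E─F∣ {F} F⊆E = trans (∣q∣+∣p─q∣ E F F⊆E) card

  corank : ∀ {F} → F ⊆ E → s ∸ m ∸ ∣ F ∣ ≡ ∣ E ─ F ∣ ∸ m
  corank {F} F⊆E = begin
    s ∸ m ∸ ∣ F ∣                        ≡⟨ ∸-+-assoc s m ∣ F ∣ ⟩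
    s ∸ (m + ∣ F ∣)                      ≡⟨ cong₂ _∸_ (sym (∣F∣+∣E─F∣ F⊆E)) (+-comm m ∣ F ∣) ⟩
    (∣ F ∣ + ∣ E ─ F ∣) ∸ (∣ F ∣ + m)    ≡⟨ [m+n]∸[m+o]≡n∸o ∣ F ∣ ∣ E ─ F ∣ m ⟩
    ∣ E ─ F ∣ ∸ m                        ∎

  -- Valid for every subset `F` of `E`, flat or not: once |E - F| ≤ m, truncated subtraction gives
  -- rank 0 on both sides.
  contract-uniform : ∀ {F} → F ⊆ E → IsUniform m (contract M F) ∣ E ─ F ∣
  contract-uniform {F} F⊆E = record
    { card    = refl
    ; uniform = λ A A⊆ → begin
        rk M (A ∪ F) ∸ rk M F                             ≡⟨ cong₂ _∸_ (uniform (A ∪ F) (∪-least (⊆-trans A⊆ (p─q⊆p E F)) F⊆E)) (uniform F F⊆E) ⟩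
        ∣ A ∪ F ∣ ⊓ (s ∸ m) ∸ ∣ F ∣ ⊓ (s ∸ m)             ≡⟨ cong (λ t → t ⊓ (s ∸ m) ∸ ∣ F ∣ ⊓ (s ∸ m)) (p⊆q─r⇒∣p∪r∣ A E F A⊆) ⟩
        (∣ A ∣ + ∣ F ∣) ⊓ (s ∸ m) ∸ ∣ F ∣ ⊓ (s ∸ m)       ≡⟨ ⊓-contract ∣ A ∣ ∣ F ∣ (s ∸ m) ⟩
        ∣ A ∣ ⊓ (s ∸ m ∸ ∣ F ∣)                           ≡⟨ cong (∣ A ∣ ⊓_) (corank F⊆E) ⟩
        ∣ A ∣ ⊓ (∣ E ─ F ∣ ∸ m)                           ∎
    }

  ∣F∣<rank : ∀ {F} → F ⊆ E → m < ∣ E ─ F ∣ → ∣ F ∣ < s ∸ m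
  ∣F∣<rank F⊆E m<u = 0<n∸m⇒m<n′ (subst (0 <_) (sym (corank F⊆E)) (m<n⇒0<n∸m m<u))
    where
    0<n∸m⇒m<n′ : ∀ {a b} → 0 < b ∸ a → a < b
    0<n∸m⇒m<n′ {a} {b} lt = ≰⇒> λ b≤a → n≮0 (subst (0 <_) (m≤n⇒m∸n≡0 b≤a) lt)

  rank≤∣F∣ : ∀ {F} → F ⊆ E → ∣ E ─ F ∣ ≤ m → s ∸ m ≤ ∣ F ∣
  rank≤∣F∣ F⊆E u≤m = m∸n≡0⇒m≤n (trans (corank F⊆E) (m≤n⇒m∸n≡0 u≤m))

  addable : Subset n → Fin n → Bool
  addable F e = not (lookup E e) ∨ lookup F e ∨ (rk M F <ᵇ rk M (F ∪ ⁅ e ⁆))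

  rk-∪⁅⁆ : ∀ {F e} → F ⊆ E → lookup E e ≡ true → rk M (F ∪ ⁅ e ⁆) ≡ ∣ F ∪ ⁅ e ⁆ ∣ ⊓ (s ∸ m)
  rk-∪⁅⁆ {F} {e} F⊆E e∈E = uniform (F ∪ ⁅ e ⁆) (∪-least F⊆E (⁅x⁆⊆ (lookup⇒[]= e E e∈E)))

  flat-small : ∀ {F} → F ⊆ E → m < ∣ E ─ F ∣ → isFlatᵇ M F ≡ true
  flat-small {F} F⊆E m<u = cong₂ _∧_ (⊆⇒subsetᵇ F E F⊆E) (allᵇ-true (addable F) (allFin n) addable-true)
    where
    addable-true : ∀ e → addable F e ≡ true
    addable-true e with lookup E e in inE | lookup F e in inF
    ... | false | _     = refl
    ... | true  | true  = refl
    ... | true  | false = <ᵇ-true (subst₂ _<_ (sym rkF) (sym (rk-∪⁅⁆ F⊆E inE)) increase)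
      where
      F<r = ∣F∣<rank F⊆E m<u
      rkF : rk M F ≡ ∣ F ∣
      rkF = trans (uniform F F⊆E) (m≤n⇒m⊓n≡m (<⇒≤ F<r))
      increase : ∣ F ∣ < ∣ F ∪ ⁅ e ⁆ ∣ ⊓ (s ∸ m)
      increase = ⊓-glb (≤-reflexive (sym (∣p∪⁅x⁆∣ F e inF))) F<r

  flat-E : isFlatᵇ M E ≡ true
  flat-E = cong₂ _∧_ (⊆⇒subsetᵇ E E ⊆-refl) (allᵇ-true (addable E) (allFin n) addable-true)
    where
    addable-true : ∀ e → addable E e ≡ true
    addable-true e with lookup E e
    ... | true  = refl
    ... | false = refl

  not-flat : ∀ {F} → F ⊆ E → 0 < ∣ E ─ F ∣ → ∣ E ─ F ∣ ≤ m → isFlatᵇ M F ≡ false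
  not-flat {F} F⊆E 0<u u≤m with e , inE , inF ← ∣p─q∣>0⇒∃ E F 0<u =
    trans (cong (subsetᵇ F E ∧_) (allᵇ-false (addable F) (∈-allFin e) (addable-false e inE inF))) (∧-zeroʳ (subsetᵇ F E))
    where
    addable-false : ∀ e → lookup E e ≡ true → lookup F e ≡ false → addable F e ≡ false
    addable-false e inE inF = trans (cong₂ (λ x y → not x ∨ y ∨ (rk M F <ᵇ rk M (F ∪ ⁅ e ⁆))) inE inF)
      (<ᵇ-false (subst₂ _≤_ (sym (rk-∪⁅⁆ F⊆E inE)) (sym (trans (uniform F F⊆E) (m≥n⇒m⊓n≡n (rank≤∣F∣ F⊆E u≤m))))
        (m⊓n≤n ∣ F ∪ ⁅ e ⁆ ∣ (s ∸ m))))

  -- Sets with |E - F| > m are independent flats, those with 0 < |E - F| ≤ m span without being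
  -- flats, and `E` is the one remaining flat. Because `g` vanishes for u ≤ m, the first kind can be
  -- summed over all splittings, and `E` contributes `c`.
  flats-sum : (f : Subset n → Poly) (g : ℕ → ℕ → ℤ) (c : ℤ) (i : ℕ) →
    (∀ F → F ⊆ E → m < ∣ E ─ F ∣ → f F i ≡ g ∣ F ∣ ∣ E ─ F ∣) →
    (∀ j u → u ≤ m → g j u ≡ + 0) → f E i ≡ c →
    sumP (map f (flats M)) i ≡ bsum s g ℤ.+ c
  flats-sum f g c i proper g-small top = begin
    sumP (map f (flats M)) i
      ≡⟨ sumP-map f (flats M) i ⟩
    sumℤ (map (λ F → f F i) (flats M))
      ≡⟨ sumℤ-filter (isFlatᵇ M) (λ F → f F i) (allSubsets n) ⟩
    sumℤ (map (λ F → if isFlatᵇ M F then f F i else + 0) (allSubsets n))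
      ≡⟨ sumℤ-allSubsets n _ ⟩
    subsetSum n (λ F → if isFlatᵇ M F then f F i else + 0)
      ≡⟨ subsetSum-bsum E (λ F F⊆E → inner F (subsetᵇ⇒⊆ F E F⊆E)) (λ F F⊈E → cong (λ b → if b ∧ allᵇ (addable F) (allFin n) then f F i else + 0) F⊈E) ⟩
    bsum ∣ E ∣ (λ j u → g j u ℤ.+ monomial c 0 u)
      ≡⟨ cong (λ r → bsum r (λ j u → g j u ℤ.+ monomial c 0 u)) card ⟩
    bsum s (λ j u → g j u ℤ.+ monomial c 0 u)
      ≡⟨ bsum-+ s g (λ _ u → monomial c 0 u) ⟩
    bsum s g ℤ.+ bsum s (λ _ u → monomial c 0 u)
      ≡⟨ cong (ℤ._+_ (bsum s g)) (bsum-emptyʳ s {λ _ u → monomial c 0 u} (λ _ _ _ → refl)) ⟩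
    bsum s g ℤ.+ c ∎
    where
    inner : ∀ F → F ⊆ E → (if isFlatᵇ M F then f F i else + 0) ≡ (g ∣ F ∣ ∣ E ─ F ∣) ℤ.+ (monomial c 0 ∣ E ─ F ∣)
    inner F F⊆E with ∣ E ─ F ∣ ≤? m | ∣ E ─ F ∣ ≟ 0
    ... | no  u≰m | _ = begin
      (if isFlatᵇ M F then f F i else + 0)                        ≡⟨ cong (λ b → if b then f F i else + 0) (flat-small F⊆E (≰⇒> u≰m)) ⟩
      f F i                                                       ≡⟨ proper F F⊆E (≰⇒> u≰m) ⟩
      g ∣ F ∣ ∣ E ─ F ∣                                           ≡⟨ ℤₚ.+-identityʳ _ ⟨
      (g ∣ F ∣ ∣ E ─ F ∣) ℤ.+ + 0                                   ≡⟨ cong (ℤ._+_ (g ∣ F ∣ ∣ E ─ F ∣)) (monomial-off c 0 ∣ E ─ F ∣ λ u≡0 → u≰m (subst (_≤ m) (sym u≡0) z≤n)) ⟨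
      (g ∣ F ∣ ∣ E ─ F ∣) ℤ.+ (monomial c 0 ∣ E ─ F ∣)                ∎
    ... | yes u≤m | yes u≡0 = begin
      (if isFlatᵇ M F then f F i else + 0)                        ≡⟨ cong (λ F → if isFlatᵇ M F then f F i else + 0) (∣p─q∣≡0⇒q≡p E F F⊆E u≡0) ⟩
      (if isFlatᵇ M E then f E i else + 0)                        ≡⟨ cong (λ b → if b then f E i else + 0) flat-E ⟩
      f E i                                                       ≡⟨ top ⟩
      c                                                           ≡⟨ ℤₚ.+-identityˡ c ⟨
      + 0 ℤ.+ monomial c 0 0                                      ≡⟨ cong₂ (λ x u → x ℤ.+ monomial c 0 u) (g-small ∣ F ∣ ∣ E ─ F ∣ u≤m) u≡0 ⟨
      (g ∣ F ∣ ∣ E ─ F ∣) ℤ.+ (monomial c 0 ∣ E ─ F ∣)                ∎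
    ... | yes u≤m | no u≢0 = begin
      (if isFlatᵇ M F then f F i else + 0)                        ≡⟨ cong (λ b → if b then f F i else + 0) (not-flat F⊆E (n≢0⇒n>0 u≢0) u≤m) ⟩
      + 0                                                         ≡⟨ cong₂ ℤ._+_ (g-small ∣ F ∣ ∣ E ─ F ∣ u≤m) (monomial-off c 0 ∣ E ─ F ∣ u≢0) ⟨
      (g ∣ F ∣ ∣ E ─ F ∣) ℤ.+ (monomial c 0 ∣ E ─ F ∣)                ∎

  charPoly-restrict : ∀ F → F ⊆ E → ∀ i →
    charPoly (restrict M F) i ≡ bsum ∣ F ∣ (λ a b → sgn a ℤ.* monomial (+ 1) (∣ F ∣ ⊓ (s ∸ m) ∸ a ⊓ (s ∸ m)) i)
  charPoly-restrict F F⊆E i = begin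
    charPoly (restrict M F) i
      ≡⟨ sumP-map _ (allSubsets n) i ⟩
    sumℤ (map (λ A → (if subsetᵇ A F then monomial (sgn ∣ A ∣) (rk M F ∸ rk M A) else 0P) i) (allSubsets n))
      ≡⟨ sumℤ-allSubsets n _ ⟩
    subsetSum n (λ A → (if subsetᵇ A F then monomial (sgn ∣ A ∣) (rk M F ∸ rk M A) else 0P) i)
      ≡⟨ subsetSum-bsum F inner (λ A A⊈F → cong (λ b → (if b then monomial (sgn ∣ A ∣) (rk M F ∸ rk M A) else 0P) i) A⊈F) ⟩
    bsum ∣ F ∣ (λ a b → sgn a ℤ.* monomial (+ 1) (∣ F ∣ ⊓ (s ∸ m) ∸ a ⊓ (s ∸ m)) i) ∎
    where
    inner : ∀ A → subsetᵇ A F ≡ true →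
      (if subsetᵇ A F then monomial (sgn ∣ A ∣) (rk M F ∸ rk M A) else 0P) i
        ≡ sgn ∣ A ∣ ℤ.* monomial (+ 1) (∣ F ∣ ⊓ (s ∸ m) ∸ ∣ A ∣ ⊓ (s ∸ m)) i
    inner A A⊆F = begin
      (if subsetᵇ A F then monomial (sgn ∣ A ∣) (rk M F ∸ rk M A) else 0P) i
        ≡⟨ cong (λ b → (if b then monomial (sgn ∣ A ∣) (rk M F ∸ rk M A) else 0P) i) A⊆F ⟩
      monomial (sgn ∣ A ∣) (rk M F ∸ rk M A) i
        ≡⟨ cong₂ (λ x y → monomial (sgn ∣ A ∣) (x ∸ y) i) (uniform F F⊆E) (uniform A (⊆-trans (subsetᵇ⇒⊆ A F A⊆F) F⊆E)) ⟩
      monomial (sgn ∣ A ∣) (∣ F ∣ ⊓ (s ∸ m) ∸ ∣ A ∣ ⊓ (s ∸ m)) i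
        ≡⟨ monomial-scale (sgn ∣ A ∣) _ i ⟩
      sgn ∣ A ∣ ℤ.* monomial (+ 1) (∣ F ∣ ⊓ (s ∸ m) ∸ ∣ A ∣ ⊓ (s ∸ m)) i ∎

  charPoly-proper : ∀ F → F ⊆ E → m < ∣ E ─ F ∣ → ∀ i →
    charPoly (restrict M F) i ≡ bsum ∣ F ∣ (λ a b → sgn a ℤ.* monomial (+ 1) b i)
  charPoly-proper F F⊆E m<u i = trans (charPoly-restrict F F⊆E i)
    (bsum-cong ∣ F ∣ λ a b e → cong (λ t → sgn a ℤ.* monomial (+ 1) t i) (exponent a b e))
    where
    exponent : ∀ a b → a + b ≡ ∣ F ∣ → ∣ F ∣ ⊓ (s ∸ m) ∸ a ⊓ (s ∸ m) ≡ b
    exponent a b e = begin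
      ∣ F ∣ ⊓ (s ∸ m) ∸ a ⊓ (s ∸ m)   ≡⟨ cong₂ _∸_ (m≤n⇒m⊓n≡m F≤r) (m≤n⇒m⊓n≡m (≤-trans (subst (a ≤_) e (m≤m+n a b)) F≤r)) ⟩
      ∣ F ∣ ∸ a                       ≡⟨ cong (_∸ a) e ⟨
      a + b ∸ a                       ≡⟨ m+n∸m≡n a b ⟩
      b                               ∎
      where F≤r = <⇒≤ (∣F∣<rank F⊆E m<u)

  charPoly-top : ∀ i → charPoly (restrict M E) i ≡ uniformChar m s i
  charPoly-top i = begin
    charPoly (restrict M E) i
      ≡⟨ charPoly-restrict E ⊆-refl i ⟩
    bsum ∣ E ∣ (λ a b → sgn a ℤ.* monomial (+ 1) (∣ E ∣ ⊓ (s ∸ m) ∸ a ⊓ (s ∸ m)) i)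
      ≡⟨ cong (λ r → bsum r (λ a b → sgn a ℤ.* monomial (+ 1) (r ⊓ (s ∸ m) ∸ a ⊓ (s ∸ m)) i)) card ⟩
    bsum s (λ a b → sgn a ℤ.* monomial (+ 1) (s ⊓ (s ∸ m) ∸ a ⊓ (s ∸ m)) i)
      ≡⟨ bsum-cong s (λ a b e → cong (λ t → sgn a ℤ.* monomial (+ 1) t i) (exponent a b e)) ⟩
    uniformChar m s i ∎
    where
    exponent : ∀ a b → a + b ≡ s → s ⊓ (s ∸ m) ∸ a ⊓ (s ∸ m) ≡ b ∸ m
    exponent a b refl = begin
      s ⊓ (s ∸ m) ∸ a ⊓ (s ∸ m)        ≡⟨ cong (λ t → t ⊓ (s ∸ m) ∸ a ⊓ (s ∸ m)) (+-comm a b) ⟩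
      (b + a) ⊓ (s ∸ m) ∸ a ⊓ (s ∸ m)  ≡⟨ ⊓-contract b a (s ∸ m) ⟩
      b ⊓ (s ∸ m ∸ a)                  ≡⟨ cong (b ⊓_) (trans (∸-+-assoc s m a) (trans (cong (s ∸_) (+-comm m a)) ([m+n]∸[m+o]≡n∸o a b m))) ⟩
      b ⊓ (b ∸ m)                      ≡⟨ m≥n⇒m⊓n≡n (m∸n≤m b m) ⟩
      b ∸ m                            ∎

-- Products with powers of t and of t - 1

Σ<-monomial-≤ : ∀ n k (f : ℕ → ℤ) → n ≤ k → Σ< n (λ j → monomial (+ 1) k j ℤ.* f j) ≡ + 0
Σ<-monomial-≤ n k f n≤k = Σ<-zero n λ j j<n →
  cong (ℤ._* f j) (monomial-off (+ 1) k j (<⇒≢ (<-≤-trans j<n n≤k)))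

Σ<-monomial-> : ∀ n k (f : ℕ → ℤ) → k < n → Σ< n (λ j → monomial (+ 1) k j ℤ.* f j) ≡ f k
Σ<-monomial-> (suc n) k f (s≤s k≤n) with m≤n⇒m<n∨m≡n k≤n
... | inj₁ k<n = trans (cong₂ ℤ._+_ (Σ<-monomial-> n k f k<n)
        (cong (ℤ._* f n) (monomial-off (+ 1) k n (≢-sym (<⇒≢ k<n))))) (ℤₚ.+-identityʳ _)
... | inj₂ refl = trans (cong₂ ℤ._+_ (Σ<-monomial-≤ n n f ≤-refl)
        (trans (cong (ℤ._* f n) (monomial-diag (+ 1) n)) (ℤₚ.*-identityˡ (f n)))) (ℤₚ.+-identityˡ _)

monomial-*P : ∀ k (p : Poly) i → Σ< (suc i) (λ j → monomial (+ 1) k j ℤ.* p (i ∸ j)) ≡ shift k p i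
monomial-*P k p i with k ≤? i
... | yes k≤i = trans (Σ<-monomial-> (suc i) k (λ j → p (i ∸ j)) (s≤s k≤i)) (sym (shift-≥ k p i k≤i))
... | no  k≰i = trans (Σ<-monomial-≤ (suc i) k (λ j → p (i ∸ j)) (≰⇒> k≰i)) (sym (shift-< k p i (≰⇒> k≰i)))

-- The assumption on `p` is the expansion of (t - 1)^n.
*P-boolean : ∀ n (p r : Poly) → (∀ x → p x ≡ bsum n (λ a b → sgn a ℤ.* monomial (+ 1) b x)) →
  ∀ i → (p *P r) i ≡ bsum n (λ a b → sgn a ℤ.* shift b r i)
*P-boolean n p r p≡ i = begin
  (p *P r) i
    ≡⟨ sumℤ-upTo (suc i) (λ j → p j ℤ.* r (i ∸ j)) ⟩
  Σ< (suc i) (λ j → p j ℤ.* r (i ∸ j))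
    ≡⟨ Σ<-cong (suc i) (λ j _ → begin
         p j ℤ.* r (i ∸ j)                                              ≡⟨ cong (ℤ._* r (i ∸ j)) (p≡ j) ⟩
         bsum n (λ a b → sgn a ℤ.* monomial (+ 1) b j) ℤ.* r (i ∸ j)    ≡⟨ ℤₚ.*-comm _ (r (i ∸ j)) ⟩
         r (i ∸ j) ℤ.* bsum n (λ a b → sgn a ℤ.* monomial (+ 1) b j)    ≡⟨ bsum-* n (r (i ∸ j)) _ ⟨
         bsum n (λ a b → r (i ∸ j) ℤ.* (sgn a ℤ.* monomial (+ 1) b j))  ≡⟨ bsum-cong n (λ a b _ → swap (r (i ∸ j)) (sgn a) _) ⟩
         bsum n (λ a b → sgn a ℤ.* (monomial (+ 1) b j ℤ.* r (i ∸ j)))  ∎) ⟩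
  Σ< (suc i) (λ j → bsum n (λ a b → sgn a ℤ.* (monomial (+ 1) b j ℤ.* r (i ∸ j))))
    ≡⟨ bsum-Σ< n (suc i) (λ a b j → sgn a ℤ.* (monomial (+ 1) b j ℤ.* r (i ∸ j))) ⟨
  bsum n (λ a b → Σ< (suc i) (λ j → sgn a ℤ.* (monomial (+ 1) b j ℤ.* r (i ∸ j))))
    ≡⟨ bsum-cong n (λ a b _ → trans (Σ<-* (suc i) (sgn a) _) (cong (ℤ._*_ (sgn a)) (monomial-*P b r i))) ⟩
  bsum n (λ a b → sgn a ℤ.* shift b r i) ∎
  where
  swap : ∀ x s c → x ℤ.* (s ℤ.* c) ≡ s ℤ.* (c ℤ.* x)
  swap = solve-∀

*P-identityʳ : ∀ (p r : Poly) → (∀ x → r x ≡ monomial (+ 1) 0 x) → ∀ i → (p *P r) i ≡ p i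
*P-identityʳ p r r≡ i = begin
  (p *P r) i
    ≡⟨ sumℤ-upTo (suc i) (λ j → p j ℤ.* r (i ∸ j)) ⟩
  Σ< i (λ j → p j ℤ.* r (i ∸ j)) ℤ.+ p i ℤ.* r (i ∸ i)
    ≡⟨ cong₂ ℤ._+_
         (Σ<-zero i λ j j<i → trans (cong (ℤ._*_ (p j)) (trans (r≡ (i ∸ j)) (monomial-off (+ 1) 0 (i ∸ j) (m>n⇒m∸n≢0 j<i)))) (ℤₚ.*-zeroʳ (p j)))
         (trans (cong (ℤ._*_ (p i)) (trans (cong r (n∸n≡0 i)) (r≡ 0))) (ℤₚ.*-identityʳ (p i))) ⟩
  + 0 ℤ.+ p i
    ≡⟨ ℤₚ.+-identityˡ (p i) ⟩
  p i ∎

shift-monomial : ∀ k i → shift k (monomial (+ 1) 0) i ≡ monomial (+ 1) k i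
shift-monomial zero    i       = refl
shift-monomial (suc k) zero    = refl
shift-monomial (suc k) (suc i) = trans (shift-suc k (monomial (+ 1) 0) i) (shift-monomial k i)

-- Kazhdan-Lusztig polynomials of uniform matroids depend on the size alone

module KL (m : ℕ) {n : ℕ} (P : RawMatroid n → Poly) (kl : IsKLPoly P) where
  open IsKLPoly kl

  -- As `P` is not known to be invariant, `q` must be read off from one concrete matroid of each
  -- size, on the same `Fin n`.
  representative : ℕ → RawMatroid n
  representative s = mkMatroid (initial n s) (λ A → ∣ A ∣ ⊓ (s ∸ m))

  representative-uniform : ∀ s → s ≤ n → IsUniform m (representative s) s
  representative-uniform s s≤n = record { card = ∣initial∣ n s s≤n ; uniform = λ _ _ → refl }

  q : ℕ → Poly
  q s with s ≤? m
  ... | yes _ = 0P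
  ... | no  _ = P (representative s)

  q-small : ∀ s i → s ≤ m → q s i ≡ + 0
  q-small s i s≤m with s ≤? m
  ... | yes _   = refl
  ... | no  s≰m = ⊥-elim (s≰m s≤m)

  q-large : ∀ s i → m < s → q s i ≡ P (representative s) i
  q-large s i m<s with s ≤? m
  ... | yes s≤m = ⊥-elim (<⇒≱ m<s s≤m)
  ... | no  _   = refl

  P-deg : ∀ M s i → IsUniform m M s → m < s → s ∸ m ≤ 2 * i → P M i ≡ + 0
  P-deg M s i uni m<s s∸m≤2i = kl-deg M isMatroid (loopless m<s)
    (subst (0 <_) (sym rank≡) (m<n⇒0<n∸m m<s)) i (subst (_≤ 2 * i) (sym rank≡) s∸m≤2i)
    where open Uniform uni

  -- `loopless` does not apply, since the size of this contraction is not above `m`; it has no loops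
  -- because its ground set is empty.
  P-contract-top : ∀ M s → IsUniform m M s → ∀ i → P (contract M (ground M)) i ≡ monomial (+ 1) 0 i
  P-contract-top M s uni = kl-rank0 M/E (Uniform.isMatroid uni/E) no-elements
    (trans (Uniform.rank≡ uni/E) (trans (cong (_∸ m) (∣p─p∣≡0 E)) (0∸n≡0 m)))
    where
    E = ground M
    M/E = contract M E
    uni/E = Uniform.contract-uniform uni (⊆-refl {x = E})
    no-elements : Loopless M/E
    no-elements e e∈ = ⊥-elim (n≮0 (subst (0 <_) (∣p─p∣≡0 E)
      (subst (_≤ ∣ E ─ E ∣) (∣⁅x⁆∣≡1 e) (p⊆q⇒∣p∣≤∣q∣ (⁅x⁆⊆ e∈)))))

  -- Coefficients of (t - 1)^j p.
  booleanTimes : Poly → ℕ → ℕ → ℤ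
  booleanTimes p j i = bsum j (λ a b → sgn a ℤ.* shift b p i)

  booleanTimes-cong : ∀ {p r : Poly} j i → (∀ x → p x ≡ r x) → booleanTimes p j i ≡ booleanTimes r j i
  booleanTimes-cong j i e = bsum-cong j λ a b _ → cong (ℤ._*_ (sgn a)) (shift-cong b i λ x _ → e x)

  booleanTimes-small : ∀ j u i → u ≤ m → booleanTimes (q u) j i ≡ + 0
  booleanTimes-small j u i u≤m = bsum-zero j λ a b _ →
    trans (cong (ℤ._*_ (sgn a)) (shift-zero b i λ x _ → q-small u x u≤m)) (ℤₚ.*-zeroʳ (sgn a))

  -- The last hypothesis compares one coefficient of each product instead of whole polynomials. This
  -- is all that can be supplied for the empty flat before invariance is known.
  P-rec : ∀ M s i → IsUniform m M s → m < s →
    (∀ F → F ⊆ ground M → m < ∣ ground M ─ F ∣ →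
      (booleanTimes (P (contract M F)) ∣ F ∣ i) ≡ (booleanTimes (q ∣ ground M ─ F ∣) ∣ F ∣ i)) →
    reflect (s ∸ m) (P M) i ≡ properFlats q s i ℤ.+ uniformChar m s i
  P-rec M s i uni m<s known = begin
    reflect (s ∸ m) (P M) i
      ≡⟨ cong (λ r → reflect r (P M) i) rank≡ ⟨
    reflect (rank M) (P M) i
      ≡⟨ kl-rec M isMatroid (loopless m<s) i ⟩
    sumP (map (λ F → charPoly (restrict M F) *P P (contract M F)) (flats M)) i
      ≡⟨ flats-sum _ (λ j u → booleanTimes (q u) j i) (uniformChar m s i) i
           (λ F F⊆E m<u → trans (*P-boolean ∣ F ∣ (charPoly (restrict M F)) (P (contract M F)) (charPoly-proper F F⊆E m<u) i) (known F F⊆E m<u))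
           (λ j u u≤m → booleanTimes-small j u i u≤m)
           (trans (*P-identityʳ (charPoly (restrict M E)) (P (contract M E)) (P-contract-top M s uni) i) (charPoly-top i)) ⟩
    properFlats q s i ℤ.+ uniformChar m s i ∎
    where open Uniform uni

  -- The recursion for M involves the contraction of M by the empty flat, a matroid that is only
  -- extensionally equal to M; in degrees at least half the rank its contribution vanishes.
  P-invariant : ∀ s → m < s → s ≤ n → ∀ M → IsUniform m M s → ∀ i → P M i ≡ q s i
  P-invariant = <-rec (λ s → m < s → s ≤ n → ∀ M → IsUniform m M s → ∀ i → P M i ≡ q s i) step
    where
    step : ∀ s → (∀ {u} → u < s → m < u → u ≤ n → ∀ M → IsUniform m M u → ∀ i → P M i ≡ q u i) →
           m < s → s ≤ n → ∀ M → IsUniform m M s → ∀ i → P M i ≡ q s i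
    -- Both `M` and the representative have the coefficients `upper`, which depend on `s` and not on
    -- `M`.
    step s ih m<s s≤n M uni l = trans (value M uni l) (sym (trans (q-large s l m<s) (value (representative s) (representative-uniform s s≤n) l)))
      where
      known : ∀ M → IsUniform m M s → ∀ i → s ∸ m ≤ 2 * i → ∀ F → F ⊆ ground M → m < ∣ ground M ─ F ∣ →
        (booleanTimes (P (contract M F)) ∣ F ∣ i) ≡ (booleanTimes (q ∣ ground M ─ F ∣) ∣ F ∣ i)
      known M uni i s∸m≤2i F F⊆E m<u with m≤n⇒m<n∨m≡n (≤-trans (m≤n+m ∣ ground M ─ F ∣ ∣ F ∣) (≤-reflexive (Uniform.∣F∣+∣E─F∣ uni F⊆E)))
      ... | inj₁ u<s = booleanTimes-cong ∣ F ∣ i (ih u<s m<u (≤-trans (<⇒≤ u<s) s≤n) (contract M F) (Uniform.contract-uniform uni F⊆E))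
      ... | inj₂ u≡s = begin
        (booleanTimes (P (contract M F)) ∣ F ∣ i)         ≡⟨ cong (λ j → booleanTimes (P (contract M F)) j i) F≡0 ⟩
        + 1 ℤ.* P (contract M F) i                      ≡⟨ cong (ℤ._*_ (+ 1)) (P-deg (contract M F) ∣ ground M ─ F ∣ i (Uniform.contract-uniform uni F⊆E) m<u (subst (λ t → t ∸ m ≤ 2 * i) (sym u≡s) s∸m≤2i)) ⟩
        + 1 ℤ.* + 0                                     ≡⟨ cong (ℤ._*_ (+ 1)) (trans (q-large s i m<s) (P-deg (representative s) s i (representative-uniform s s≤n) m<s s∸m≤2i)) ⟨
        + 1 ℤ.* q s i                                   ≡⟨ cong₂ (λ u j → booleanTimes (q u) j i) u≡s F≡0 ⟨
        (booleanTimes (q ∣ ground M ─ F ∣) ∣ F ∣ i)       ∎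
        where
        F≡0 : ∣ F ∣ ≡ 0
        F≡0 = +-cancelʳ-≡ s ∣ F ∣ 0 (trans (cong (_+_ ∣ F ∣) (sym u≡s)) (Uniform.∣F∣+∣E─F∣ uni F⊆E))
      -- Below half the rank, the coefficient `l` is read from the recursion at the reflected degree
      -- s - m - l, which lies in the upper half, where `known` applies.
      upper : ℕ → ℤ
      upper l with s ∸ m ≤? 2 * l
      ... | yes _ = + 0
      ... | no  _ = properFlats q s (s ∸ m ∸ l) ℤ.+ uniformChar m s (s ∸ m ∸ l)
      value : ∀ M → IsUniform m M s → ∀ l → P M l ≡ upper l
      value M uni l with s ∸ m ≤? 2 * l
      ... | yes e≤2l = P-deg M s l uni m<s e≤2l
      ... | no  e≰2l = begin
        P M l                        ≡⟨ reflect-+ (P M) i l ⟨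
        reflect (i + l) (P M) i      ≡⟨ cong (λ r → reflect r (P M) i) (m∸n+n≡m l≤e) ⟩
        reflect (s ∸ m) (P M) i      ≡⟨ P-rec M s i uni m<s (known M uni i e≤2i) ⟩
        properFlats q s i ℤ.+ uniformChar m s i ∎
        where
        i = s ∸ m ∸ l
        2l≤e : l + (l + 0) ≤ s ∸ m
        2l≤e = <⇒≤ (≰⇒> e≰2l)
        l≤e : l ≤ s ∸ m
        l≤e = ≤-trans (m≤m+n l _) 2l≤e
        l≤i : l ≤ i
        l≤i = subst (_≤ i) (trans (m+n∸m≡n l (l + 0)) (+-identityʳ l)) (∸-monoˡ-≤ l 2l≤e)
        e≤2i : s ∸ m ≤ 2 * i
        e≤2i = subst₂ _≤_ (m∸n+n≡m l≤e) (cong (_+_ i) (sym (+-identityʳ i))) (+-monoʳ-≤ i l≤i)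

  P-contract : ∀ M s → IsUniform m M s → ∀ F → F ⊆ ground M → m < ∣ ground M ─ F ∣ →
    ∀ i → P (contract M F) i ≡ q ∣ ground M ─ F ∣ i
  P-contract M s uni F F⊆E m<u = P-invariant ∣ ground M ─ F ∣ m<u (∣p∣≤n (ground M ─ F)) (contract M F) (Uniform.contract-uniform uni F⊆E)

  isUniformKL : IsUniformKL m n q
  isUniformKL = record
    { small = q-small
    ; deg   = λ s i m<s s≤n e≤2i → trans (q-large s i m<s) (P-deg (representative s) s i (representative-uniform s s≤n) m<s e≤2i)
    ; rec   = λ s i m<s s≤n → let M = representative s; uni = representative-uniform s s≤n in begin
        reflect (s ∸ m) (q s) i
          ≡⟨ reflect-cong (s ∸ m) i (λ x → q-large s x m<s) ⟩
        reflect (s ∸ m) (P M) i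
          -- With invariance established, the comparison holds in every degree and also for the
          -- empty flat.
          ≡⟨ P-rec M s i uni m<s (λ F F⊆E m<u → booleanTimes-cong ∣ F ∣ i (P-contract M s uni F F⊆E m<u)) ⟩
        properFlats q s i ℤ.+ uniformChar m s i ∎
    }
    where
    reflect-cong : ∀ {p r : Poly} e i → (∀ x → p x ≡ r x) → reflect e p i ≡ reflect e r i
    reflect-cong e i h with i ≤ᵇ e
    ... | true  = h (e ∸ i)
    ... | false = refl

  ZPoly-uniform : ∀ M s → IsUniform m M s → ∀ i →
    ZPoly P M i ≡ uniformZ q s i ℤ.+ monomial (+ 1) (s ∸ m) i
  ZPoly-uniform M s uni i = flats-sum (λ F → shift (rk M F) (P (contract M F))) (λ j u → shift j (q u) i) (monomial (+ 1) (s ∸ m) i) i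
    (λ F F⊆E m<u → begin
       shift (rk M F) (P (contract M F)) i
         ≡⟨ cong (λ r → shift r (P (contract M F)) i) (trans (uniform F F⊆E) (m≤n⇒m⊓n≡m (<⇒≤ (∣F∣<rank F⊆E m<u)))) ⟩
       (shift ∣ F ∣ (P (contract M F)) i)
         ≡⟨ shift-cong ∣ F ∣ i (λ x _ → P-contract M s uni F F⊆E m<u x) ⟩
       (shift ∣ F ∣ (q ∣ E ─ F ∣) i) ∎)
    (λ j u u≤m → shift-zero j i λ x _ → q-small u x u≤m)
    (begin
       shift (rank M) (P (contract M E)) i     ≡⟨ cong (λ r → shift r (P (contract M E)) i) rank≡ ⟩
       shift (s ∸ m) (P (contract M E)) i      ≡⟨ shift-cong (s ∸ m) i (λ x _ → P-contract-top M s uni x) ⟩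
       shift (s ∸ m) (monomial (+ 1) 0) i      ≡⟨ shift-monomial (s ∸ m) i ⟩
       monomial (+ 1) (s ∸ m) i                ∎)
    where
    open Uniform uni
    open IsUniform uni

-- The theorem for the uniform matroid of rank d

U-uniform : ∀ m d → IsUniform m (U m d) (m + d)
U-uniform m d = record
  { card    = ∣⊤∣≡n (m + d)
  ; uniform = λ A _ → cong (∣ A ∣ ⊓_) (sym (m+n∸m≡n m d))
  }

theorem3p1 : (m d : ℕ) → 0 < m → 0 < d →
    (P : RawMatroid (m + d) → Poly) → IsKLPoly P →
    (ZPoly P (U m d) d ≡ + 1) ×
    (∀ i → i < d →
    (+ m) ℤ.* (+ ((d + 2 * m) C m)) ℤ.* ZPoly P (U m d) i
    ≡ (+ (((d + 2 * m) C (i + m)) * (d C i))) ℤ.*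
    sumFrom1 m (λ h → sgn (suc h) ℤ.* (+ (h * ((i + m) C (m ∸ h)) * (((d + m) ∸ (i + h + 1)) C (m ∸ 1))))))
theorem3p1 m d 0<m _ P kl = top , below
  where
  open KL m P kl
  open UniformZ isUniformKL
  instance
    m≢0 : NonZero m
    m≢0 = >-nonZero 0<m

  Z≡ : ∀ i → ZPoly P (U m d) i ≡ uniformZ q (m + d) i ℤ.+ monomial (+ 1) d i
  Z≡ i = trans (ZPoly-uniform (U m d) (m + d) (U-uniform m d) i)
    (cong (λ e → uniformZ q (m + d) i ℤ.+ monomial (+ 1) e i) (m+n∸m≡n m d))

  top : ZPoly P (U m d) d ≡ + 1
  -- Degree d is reached by the flat `E` alone.
  top = trans (Z≡ d) (cong₂ ℤ._+_ (uniformZ-top d ≤-refl) (monomial-diag (+ 1) d))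

  -- The bound `d` shadows the rank of the theorem, so that `suc κ + i` can be replaced by that rank
  -- while `q` stays the one built from the given `P`.
  Goal : ℕ → ℕ → Set
  Goal i d = + m ℤ.* + ((d + 2 * m) C m) ℤ.* uniformZ q (m + d) i
    ≡ + (((d + 2 * m) C (i + m)) * (d C i)) ℤ.*
      sumFrom1 m (λ h → sgn (suc h) ℤ.* (+ (h * ((i + m) C (m ∸ h)) * (((d + m) ∸ (i + h + 1)) C (m ∸ 1)))))

  goal : ∀ κ i → m + (suc κ + i) ≤ m + d → Goal i (suc κ + i)
  goal κ i bound = trans (formula κ i bound)
    (cong (ℤ._*_ (+ (((suc κ + i + 2 * m) C (i + m)) * ((suc κ + i) C i)))) (sym (sumFrom1-altSum m κ i)))

  below : ∀ i → i < d → _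
  below i i<d = trans (cong (ℤ._*_ (+ m ℤ.* + ((d + 2 * m) C m))) Zi)
    (subst (Goal i) κ+i (goal κ i (≤-reflexive (cong (_+_ m) κ+i))))
    where
    κ = d ∸ suc i
    κ+i : suc κ + i ≡ d
    κ+i = trans (sym (+-suc κ i)) (m∸n+n≡m i<d)
    Zi : ZPoly P (U m d) i ≡ uniformZ q (m + d) i
    Zi = trans (Z≡ i) (trans (cong (ℤ._+_ (uniformZ q (m + d) i)) (monomial-off (+ 1) d i (<⇒≢ i<d))) (ℤₚ.+-identityʳ _))
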